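{- Let $n\ge k\ge 3$ be integers, $m=\lceil (n-k)/2\rceil$, and let $\mathcal{F}$ be a family of subsets of $[n]$ containing neither a copy of $Y_k$ nor a copy of $Y'_k$ on consecutive levels. Let $\sigma$ be any cyclic permutation of $[n]$, and for $0\le i\le n$ let $x_i$ be the number of intervals of size $i$ along $\sigma$ that belong to $\mathcal{F}$. Then \[ |\{\emptyset,[n]\} \cap \mathcal{F}|\cdot n + \sum_{i = 1}^{n-1}\binom{n}{i}x_i \le n\cdot\big(2^{n} - S(n,k,m)\big) + n-1. \]
   Context: For integers $k\ge 2$ and $r$, $S(n,k,r) = \sum_{0\le i\le n,\ i \equiv r \pmod k}\binom{n}{i}$. A family $\mathcal{F}$ of subsets of $[n]$ contains a copy of $Y_k$ on consecutive levels if it contains $k+1$ distinct sets $F_1, F_2, G_1, \ldots, G_{k-1}$ with $G_1\subset \cdots \subset G_{k-1} \subset F_1$, $G_{k-1}\subset F_2$, and $|F_1| = |F_2| = |G_{k-1}|+1 = \cdots = |G_1|+k-1$; it contains a copy of $Y'_k$ on consecutive levels if it contains $k+1$ distinct sets with $G_1\supset\cdots\supset G_{k-1}\supset F_1$, $G_{k-1}\supset F_2$, and $|F_1|=|F_2|=|G_{k-1}|-1=\cdots=|G_1|-(k-1)$. A cyclic permutation $\sigma$ of $[n]$ is a cyclic ordering $a_1,a_2,\ldots,a_n,a_1$ of the elements of $[n]$; an interval along $\sigma$ is a set $\{a_{t+1},a_{t+2},\ldots,a_{t+s}\}$ (indices modulo $n$) for some $t$ and $0\le s\le n$. Thus the intervals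 of size $0$ and $n$ are $\emptyset$ and $[n]$, and for $1\le s\le n-1$ there are exactly $n$ intervals of size $s$. -}

module Defs where

open import Data.Nat using (ℕ; zero; suc; _+_; _*_; _∸_; _^_; _≤_; _<_; NonZero)
open import Data.Nat.DivMod using (_%_; _/_; m%n<n)
open import Data.Nat.Combinatorics using (_C_)
open import Data.Fin using (Fin; toℕ; fromℕ<)
open import Data.Fin.Subset using (Subset; ⊥; ⊤; ⁅_⁆; _∪_; _⊂_; ∣_∣)
open import Data.Fin.Permutation using (Permutation′; _⟨$⟩ʳ_)
open import Data.List using (List; []; _∷_; map; upTo; allFin; foldr)
open import Data.Nat.ListAction using (sum)
open import Data.Bool using (Bool; true; false; if_then_else_)
open import Relation.Binary.PropositionalEquality using (_≡_; _≢_)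
open import Data.Product using (_×_; Σ)

Family : ℕ → Set
Family n = Subset n → Bool

_∈F_ : ∀ {n} → Subset n → Family n → Set
A ∈F 𝓕 = 𝓕 A ≡ true

sumTo : ℕ → (ℕ → ℕ) → ℕ
sumTo n f = sum (map f (upTo (suc n)))

S : (n k r : ℕ) → .{{NonZero k}} → ℕ
S n k r = sumTo n (λ i → if ⌊ i % k ≟ r % k ⌋ then n C i else 0)
  where
    open import Data.Nat using (_≟_)
    open import Relation.Nullary.Decidable using (⌊_⌋)

record CopyY {n : ℕ} (k : ℕ) (𝓕 : Family n) : Set where
  field
    F₁ F₂ : Subset n
    G : ℕ → Subset n
    F₁∈ : F₁ ∈F 𝓕
    F₂∈ : F₂ ∈F 𝓕
    G∈ : ∀ i → 1 ≤ i → i ≤ k ∸ 1 → G i ∈F 𝓕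
    F₁≢F₂ : F₁ ≢ F₂
    G≢G : ∀ i j → 1 ≤ i → i ≤ k ∸ 1 → 1 ≤ j → j ≤ k ∸ 1 → i ≢ j → G i ≢ G j
    G≢F₁ : ∀ i → 1 ≤ i → i ≤ k ∸ 1 → G i ≢ F₁
    G≢F₂ : ∀ i → 1 ≤ i → i ≤ k ∸ 1 → G i ≢ F₂
    chain : ∀ i → 1 ≤ i → suc i ≤ k ∸ 1 → G i ⊂ G (suc i)
    top₁ : G (k ∸ 1) ⊂ F₁
    top₂ : G (k ∸ 1) ⊂ F₂
    size₁₂ : ∣ F₁ ∣ ≡ ∣ F₂ ∣
    sizeG : ∀ i → 1 ≤ i → i ≤ k ∸ 1 → ∣ F₁ ∣ ≡ ∣ G i ∣ + (k ∸ i)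

record CopyY′ {n : ℕ} (k : ℕ) (𝓕 : Family n) : Set where
  field
    F₁ F₂ : Subset n
    G : ℕ → Subset n
    F₁∈ : F₁ ∈F 𝓕
    F₂∈ : F₂ ∈F 𝓕
    G∈ : ∀ i → 1 ≤ i → i ≤ k ∸ 1 → G i ∈F 𝓕
    F₁≢F₂ : F₁ ≢ F₂
    G≢G : ∀ i j → 1 ≤ i → i ≤ k ∸ 1 → 1 ≤ j → j ≤ k ∸ 1 → i ≢ j → G i ≢ G j
    G≢F₁ : ∀ i → 1 ≤ i → i ≤ k ∸ 1 → G i ≢ F₁
    G≢F₂ : ∀ i → 1 ≤ i → i ≤ k ∸ 1 → G i ≢ F₂
    chain : ∀ i → 1 ≤ i → suc i ≤ k ∸ 1 → G (suc i) ⊂ G i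
    top₁ : F₁ ⊂ G (k ∸ 1)
    top₂ : F₂ ⊂ G (k ∸ 1)
    size₁₂ : ∣ F₁ ∣ ≡ ∣ F₂ ∣
    sizeG : ∀ i → 1 ≤ i → i ≤ k ∸ 1 → ∣ G i ∣ ≡ ∣ F₁ ∣ + (k ∸ i)

-- A cyclic permutation σ of [n] is given by a bijection σ : Fin n → Fin n,
-- read as the cyclic order a₀, a₁, …, a_{n-1}, a₀ with a_j = σ j.
-- Interval along σ starting after position t, of size s:
--   { a_{t+1}, …, a_{t+s} }  (indices mod n).
interval : ∀ {n} .{{_ : NonZero n}} → Permutation′ n → Fin n → ℕ → Subset n
interval {n} σ t s =
  foldr (λ j acc → ⁅ σ ⟨$⟩ʳ fromℕ< (m%n<n (toℕ t + suc j) n) ⁆ ∪ acc) ⊥ (upTo s)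

-- x_i : number of intervals of size i (1 ≤ i ≤ n-1) along σ that belong to 𝓕.
-- For 1 ≤ i ≤ n-1 the n intervals indexed by t : Fin n are pairwise distinct.
x : ∀ {n} .{{_ : NonZero n}} → Family n → Permutation′ n → ℕ → ℕ
x {n} 𝓕 σ i = sum (map (λ t → if 𝓕 (interval σ t i) then 1 else 0) (allFin n))

-- |{∅, [n]} ∩ 𝓕|   (∅ ≠ [n] as n ≥ 1)
endpoints : ∀ {n} → Family n → ℕ
endpoints 𝓕 = (if 𝓕 ⊥ then 1 else 0) + (if 𝓕 ⊤ then 1 else 0)

intervalSum : ∀ {n} .{{_ : NonZero n}} → Family n → Permutation′ n → ℕ
intervalSum {n} 𝓕 σ = sum (map (λ i → (n C suc i) * x 𝓕 σ (suc i)) (upTo (n ∸ 1)))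

{-# OPTIONS --safe #-}

-- Let y i be n minus the number of intervals of size i in 𝓕 (for i = 0 and i = n each of the n
-- starting points gives the same interval), so that the claim becomes n (S(n,k,m) − 1) < Σ C(n,i) y i.
-- On k consecutive levels away from ∅ and [n] the sum of the y i is at least n: the intervals there
-- split into n straight chains {interval t s, interval t (s+1), …}, and two full chains are always
-- separated by a chain missing two sets.  A window containing ∅ or [n] may only reach n / 2, but if
-- ∅ ∈ 𝓕 and the bottom window is that tight, then the next window exceeds n.
-- These window inequalities are combined by linear-programming duality.  With A s the sum of C(n,j)
-- over j ≤ s, j ≡ s (mod k), the window starting at level s ≤ m gets the multiplier A s − A (s − 1),
-- and those above are treated symmetrically.  The total is n S(n,k,m), and the coefficient of y i
-- stays below C(n,i) because r ↦ S(n,k,r) is cyclically unimodal with its minimum at r = m.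
module Submission where

open import Defs
open import Data.Bool using (Bool; true; false; if_then_else_)
open import Data.Empty using (⊥-elim) renaming (⊥ to Empty)
open import Data.Fin using (Fin; toℕ; fromℕ<; zero; suc)
open import Data.Fin.Permutation using (Permutation′; _⟨$⟩ʳ_)
open import Data.Fin.Properties using (fromℕ<-injective; fromℕ<-cong)
open import Data.Fin.Subset using (Subset; ⊥; ⊤; ⁅_⁆; _∪_; _⊂_; _⊆_; _∈_; _∉_; ∣_∣)
open import Data.Fin.Subset.Properties
open import Data.List using (foldr; map; upTo; allFin; applyUpTo; tabulate)
open import Data.List.Properties using (map-cong; map-upTo; map-tabulate)
open import Data.Nat
open import Data.Nat.Combinatorics
  using (_C_; nCn≡1; nC1≡n; nCk≡nC[n∸k]; k>n⇒nCk≡0; nCk+nC[k+1]≡[n+1]C[k+1])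
open import Data.Nat.DivMod
open import Data.Nat.ListAction using (sum)
open import Data.Nat.Properties
open import Data.Nat.Tactic.RingSolver using (solve-∀)
open import Data.Product using (_×_; _,_; proj₁; proj₂)
open import Data.Sum using (_⊎_; inj₁; inj₂)
open import Data.Vec using (here; there; _∷_)
open import Function using (_∘_; id)
open import Function.Bundles using (Injection)
open import Function.Properties.Inverse using (↔⇒↣)
open import Relation.Binary.PropositionalEquality
open import Relation.Nullary using (¬_; yes; no)
open import Relation.Nullary.Decidable using (⌊_⌋)

-- Finite sums

∑ : ℕ → (ℕ → ℕ) → ℕ
∑ n f = sum (applyUpTo f n)

-- Reduces linear arithmetic to a ring identity: A is a sum of the left-hand sides of known
-- inequalities, B of their right-hand sides, and e is the slack.
≤-certificate : ∀ {A B c d} e → A ≤ B → B + c + e ≡ A + d → c ≤ d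
≤-certificate {A} {B} {c} {d} e A≤B eq = m+n≤o⇒m≤o c (+-cancelˡ-≤ B (c + e) d (begin
  B + (c + e) ≡⟨ sym (+-assoc B c e) ⟩
  B + c + e   ≡⟨ eq ⟩
  A + d       ≤⟨ +-monoˡ-≤ d A≤B ⟩
  B + d       ∎))
  where open ≤-Reasoning

∑-cong : ∀ n {f g} → (∀ i → i < n → f i ≡ g i) → ∑ n f ≡ ∑ n g
∑-cong zero    h = refl
∑-cong (suc n) h = cong₂ _+_ (h 0 z<s) (∑-cong n (λ i i<n → h (suc i) (s<s i<n)))

∑-mono : ∀ n {f g} → (∀ i → i < n → f i ≤ g i) → ∑ n f ≤ ∑ n g
∑-mono zero    h = z≤n
∑-mono (suc n) h = +-mono-≤ (h 0 z<s) (∑-mono n (λ i i<n → h (suc i) (s<s i<n)))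

∑-const : ∀ n c → ∑ n (λ _ → c) ≡ n * c
∑-const zero    c = refl
∑-const (suc n) c = cong (c +_) (∑-const n c)

∑-one : ∀ n → ∑ n (λ _ → 1) ≡ n
∑-one n = trans (∑-const n 1) (*-identityʳ n)

∑-zero : ∀ n {f} → (∀ i → i < n → f i ≡ 0) → ∑ n f ≡ 0
∑-zero n h = trans (∑-cong n h) (trans (∑-const n 0) (*-zeroʳ n))

∑-+ : ∀ n f g → ∑ n (λ i → f i + g i) ≡ ∑ n f + ∑ n g
∑-+ zero    f g = refl
∑-+ (suc n) f g rewrite ∑-+ n (f ∘ suc) (g ∘ suc) =
  interchange (f 0) (g 0) (∑ n (f ∘ suc)) (∑ n (g ∘ suc))
  where
  interchange : ∀ a b c d → a + b + (c + d) ≡ a + c + (b + d)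
  interchange = solve-∀

∑-*ˡ : ∀ n c f → ∑ n (λ i → c * f i) ≡ c * ∑ n f
∑-*ˡ zero    c f = sym (*-zeroʳ c)
∑-*ˡ (suc n) c f = trans (cong (c * f 0 +_) (∑-*ˡ n c (f ∘ suc))) (sym (*-distribˡ-+ c (f 0) _))

∑-swap : ∀ m n (f : ℕ → ℕ → ℕ) → ∑ m (λ i → ∑ n (f i)) ≡ ∑ n (λ j → ∑ m (λ i → f i j))
∑-swap zero    n f = sym (∑-zero n (λ _ _ → refl))
∑-swap (suc m) n f = trans (cong (∑ n (f 0) +_) (∑-swap m n (f ∘ suc)))
                           (sym (∑-+ n (f 0) (λ j → ∑ m (λ i → f (suc i) j))))

∑-split : ∀ m n f → ∑ (m + n) f ≡ ∑ m f + ∑ n (λ i → f (m + i))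
∑-split zero    n f = refl
∑-split (suc m) n f = trans (cong (f 0 +_) (∑-split m n (f ∘ suc))) (sym (+-assoc (f 0) _ _))

∑-last : ∀ n f → ∑ (suc n) f ≡ ∑ n f + f n
∑-last zero    f = +-identityʳ (f 0)
∑-last (suc n) f = trans (cong (f 0 +_) (∑-last n (f ∘ suc))) (sym (+-assoc (f 0) _ _))

∑-reverse : ∀ n {f g} → (∀ i → i < n → f (n ∸ suc i) ≡ g i) → ∑ n f ≡ ∑ n g
∑-reverse n {f} h = trans (reverse n f) (∑-cong n h)
  where
  open ≡-Reasoning
  reverse : ∀ n f → ∑ n f ≡ ∑ n (λ i → f (n ∸ suc i))
  reverse zero          f = refl
  reverse (suc n)       f = begin
    f 0 + ∑ n (f ∘ suc)                              ≡⟨ +-comm (f 0) _ ⟩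
    ∑ n (f ∘ suc) + f 0                              ≡⟨ cong₂ _+_ (reverse n (f ∘ suc)) (cong f (sym (n∸n≡0 n))) ⟩
    ∑ n (λ i → f (suc (n ∸ suc i))) + f (n ∸ n)
      ≡⟨ cong (_+ f (n ∸ n)) (∑-cong n (λ i i<n → cong f (sym (+-∸-assoc 1 i<n)))) ⟩
    ∑ n (λ i → f (suc n ∸ suc i)) + f (n ∸ n)        ≡⟨ sym (∑-last n (λ i → f (n ∸ i))) ⟩
    ∑ (suc n) (λ i → f (n ∸ i))                      ∎

∑-term : ∀ n f i → i < n → f i ≤ ∑ n f
∑-term (suc n) f zero    _         = m≤m+n (f 0) _
∑-term (suc n) f (suc i) (s<s i<n) = ≤-trans (∑-term n (f ∘ suc) i i<n) (m≤n+m _ (f 0))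

∑-tight : ∀ m g → (∀ t → 1 ≤ g t) → ∑ m g ≤ m → ∀ i → i < m → g i ≡ 1
∑-tight (suc m) g h le zero _ = ≤-antisym (+-cancelʳ-≤ m (g 0) 1 (begin
  g 0 + m             ≡⟨ cong (g 0 +_) (∑-one m) ⟨
  g 0 + ∑ m (λ _ → 1) ≤⟨ +-monoʳ-≤ (g 0) (∑-mono m (λ t _ → h (suc t))) ⟩
  ∑ (suc m) g         ≤⟨ le ⟩
  suc m               ∎)) (h 0)
  where open ≤-Reasoning
∑-tight (suc m) g h le (suc i) (s≤s i<m) =
  ∑-tight m (g ∘ suc) (h ∘ suc) (s≤s⁻¹ (≤-trans (+-monoˡ-≤ _ (h 0)) le)) i i<m

∑-upTo : ∀ n f → sum (map f (upTo n)) ≡ ∑ n f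
∑-upTo n f = cong sum (map-upTo f n)

∑-allFin : ∀ n f → sum (map (f ∘ toℕ) (allFin n)) ≡ ∑ n f
∑-allFin n f = trans (cong sum (map-tabulate {n = n} id (f ∘ toℕ))) (∑-tabulate n f)
  where
  ∑-tabulate : ∀ n f → sum (tabulate (λ (i : Fin n) → f (toℕ i))) ≡ ∑ n f
  ∑-tabulate zero    f = refl
  ∑-tabulate (suc n) f = cong (f 0 +_) (∑-tabulate n (f ∘ suc))

∑-rotate : ∀ n f → (∀ i → f (n + i) ≡ f i) → ∀ c → ∑ n (λ i → f (c + i)) ≡ ∑ n f
∑-rotate n f periodic zero    = refl
∑-rotate n f periodic (suc c) = trans step (∑-rotate n f periodic c)
  where
  open ≡-Reasoning
  wrap : f (c + n) ≡ f (c + 0)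
  wrap = trans (cong f (+-comm c n)) (trans (periodic c) (cong f (sym (+-identityʳ c))))
  step : ∑ n (λ i → f (suc c + i)) ≡ ∑ n (λ i → f (c + i))
  -- Adding `f (c + 0)`, which periodicity identifies with `f (c + n)`, turns both sides into the
  -- sum of `n + 1` consecutive values from `c`.
  step = +-cancelˡ-≡ (f (c + 0)) _ _ (begin
    f (c + 0) + ∑ n (λ i → f (suc c + i)) ≡⟨ cong (f (c + 0) +_) (∑-cong n (λ i _ → cong f (sym (+-suc c i)))) ⟩
    ∑ (suc n) (λ i → f (c + i))           ≡⟨ ∑-last n (λ i → f (c + i)) ⟩
    ∑ n (λ i → f (c + i)) + f (c + n)     ≡⟨ cong (∑ n (λ i → f (c + i)) +_) wrap ⟩
    ∑ n (λ i → f (c + i)) + f (c + 0)     ≡⟨ +-comm _ (f (c + 0)) ⟩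
    f (c + 0) + ∑ n (λ i → f (c + i))     ∎)

zero-or-positive : ∀ m → m ≡ 0 ⊎ 1 ≤ m
zero-or-positive zero    = inj₁ refl
zero-or-positive (suc m) = inj₂ z<s

-- By parity, a deficit of one in a doubled inequality disappears on halving.
halve-≤ : ∀ {a b} → a + a ≤ suc (b + b) → a ≤ b
halve-≤ {a} {b} h = ≮⇒≥ λ b<a → 1+n≰n (begin
  suc (suc (b + b)) ≡⟨ cong suc (+-suc b b) ⟨
  suc b + suc b     ≤⟨ +-mono-≤ b<a b<a ⟩
  a + a             ≤⟨ h ⟩
  suc (b + b)       ∎)
  where open ≤-Reasoning

-- Windows of k consecutive levels

-- f t s says whether the interval of size s starting after position t belongs to the family; the
-- intervals covering it are those at (t , s + 1) and (t − 1 , s + 1).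
module Grid
  (n k′ : ℕ) (0<n : 0 < n) (f : ℕ → ℕ → Bool)
  (periodic : ∀ t s → f (n + t) s ≡ f t s)
  -- In `noY` the stem is the straight chain `1 + t` with its bottom set bent to `2 + t`. In `noY′`
  -- the top of the stem may be bent (`v ≡ t`) or straight (`v ≡ suc t`). The conditions on `s` keep
  -- the two branch sets off level `n` and level `0` respectively, where neighbouring intervals
  -- coincide.
  (noY : ∀ t s → s + (3 + k′) ≤ n → f (2 + t) s ≡ true →
         (∀ i → i ≤ 1 + k′ → f (1 + t) (suc i + s) ≡ true) →
         f t (2 + k′ + s) ≡ true → Empty)
  (noY′ : ∀ v t s → v ≡ t ⊎ v ≡ suc t → 1 ≤ s → s + (2 + k′) ≤ n →
          f v (2 + k′ + s) ≡ true → (∀ i → i ≤ 1 + k′ → f (1 + t) (i + s) ≡ true) →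
          f (2 + t) s ≡ true → Empty)
  where

  k : ℕ
  k = 3 + k′

  missing : ℕ → ℕ → ℕ
  missing t s = if f t s then 0 else 1

  y : ℕ → ℕ
  y s = ∑ n (λ t → missing t s)

  Y : ℕ → ℕ
  Y s = ∑ k (λ i → y (i + s))

  -- The deficiency of a single straight chain; `Y s` is the total over one lap.
  b : ℕ → ℕ → ℕ
  b s t = ∑ k (λ i → missing t (i + s))

  Y≡∑b : ∀ s → Y s ≡ ∑ n (b s)
  Y≡∑b s = ∑-swap k n (λ i t → missing t (i + s))

  missing-periodic : ∀ s t → missing (n + t) s ≡ missing t s
  missing-periodic s t = cong (λ p → if p then 0 else 1) (periodic t s)

  b-periodic : ∀ s t → b s (n + t) ≡ b s t
  b-periodic s t = ∑-cong k (λ i _ → missing-periodic (i + s) t)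

  present : ∀ {t s} → missing t s ≡ 0 → f t s ≡ true
  present {t} {s} m≡0 with f t s | m≡0
  ... | true  | _  = refl
  ... | false | ()

  present-or-missing : ∀ t s → f t s ≡ true ⊎ missing t s ≡ 1
  present-or-missing t s with f t s
  ... | true  = inj₁ refl
  ... | false = inj₂ refl

  absent : ∀ t s → (f t s ≡ true → Empty) → missing t s ≡ 1
  absent t s h with present-or-missing t s
  ... | inj₁ p = ⊥-elim (h p)
  ... | inj₂ m = m

  ∑-missing-0 : ∀ m (h : ℕ → ℕ) t → ∑ m (λ i → missing t (h i)) ≡ 0 →
                ∀ i → i < m → f t (h i) ≡ true
  ∑-missing-0 m h t ∑≡0 i i<m =
    present (n≤0⇒n≡0 (subst (missing t (h i) ≤_) ∑≡0 (∑-term m (λ i → missing t (h i)) i i<m)))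

  b-0 : ∀ s t → b s t ≡ 0 → ∀ i → i < k → f t (i + s) ≡ true
  b-0 s t b≡0 = ∑-missing-0 k (_+ s) t b≡0

  -- The bottom set is split off because `noY` replaces it by the bottom of the next chain.
  upper : ℕ → ℕ → ℕ
  upper s t = ∑ (2 + k′) (λ i → missing t (suc i + s))

  upper-0 : ∀ s t → upper s t ≡ 0 → ∀ i → i ≤ 1 + k′ → f t (suc i + s) ≡ true
  upper-0 s t u≡0 i i≤ = ∑-missing-0 (2 + k′) (λ i → suc i + s) t u≡0 i (s≤s i≤)

  extend : ∀ s j {a} c → a ≤ ∑ j (b s ∘ suc) → c ≤ missing (suc j) s + upper s (suc j) →
           c + a ≤ ∑ (suc j) (b s ∘ suc)
  extend s j {a} c h h′ = begin
    c + a                                                      ≡⟨ +-comm c a ⟩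
    a + c                                                      ≤⟨ +-mono-≤ h h′ ⟩
    ∑ j (b s ∘ suc) + (missing (suc j) s + upper s (suc j))    ≡⟨ ∑-last j (b s ∘ suc) ⟨
    ∑ (suc j) (b s ∘ suc)                                      ∎
    where open ≤-Reasoning

  -- The straight chains 1, …, j are scanned in turn.  Either they miss at least j sets, or they
  -- miss at least j − 1 and the last of them forces the bottom of the next one to be missing.
  data Scan (s : ℕ) : ℕ → Set where
    covered : ∀ {j} → j ≤ ∑ j (b s ∘ suc) → Scan s j
    forcing : ∀ {j} → j ≤ ∑ (suc j) (b s ∘ suc) → upper s (suc j) ≡ 0 →
              f (suc j) s ≡ true ⊎ f j (2 + k′ + s) ≡ true → Scan s (suc j)

  module _ (s : ℕ) (1≤s : 1 ≤ s) (s+k≤n : s + k ≤ n) where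

    -- If chain `suc j` is full, the next bottom would be the second lower branch of a straight
    -- `Y′`. If the top of chain `j` is present, the next bottom would start a `Y` whose two upper
    -- branches are the tops of chains `suc j` and `j`.
    forced-missing : ∀ j → upper s (suc j) ≡ 0 → f (suc j) s ≡ true ⊎ f j (2 + k′ + s) ≡ true →
                     missing (2 + j) s ≡ 1
    forced-missing j u≡0 (inj₁ bottom) = absent (2 + j) s
      (noY′ (suc j) j s (inj₂ refl) 1≤s (≤-trans (+-monoʳ-≤ s (n≤1+n _)) s+k≤n)
        (upper-0 s (suc j) u≡0 (1 + k′) ≤-refl)
        λ { zero _ → bottom ; (suc i) i≤ → upper-0 s (suc j) u≡0 i (≤-trans (n≤1+n i) i≤) })
    forced-missing j u≡0 (inj₂ top) = absent (2 + j) s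
      (λ bottom → noY j s s+k≤n bottom (upper-0 s (suc j) u≡0) top)

    scan-step : ∀ j → Scan s j → Scan s (suc j)
    scan-step j (covered h) with zero-or-positive (upper s (suc j)) | present-or-missing (suc j) s
    ... | inj₁ u≡0 | inj₁ p = forcing (extend s j 0 h z≤n) u≡0 (inj₁ p)
    ... | inj₁ u≡0 | inj₂ m = covered (extend s j 1 h
      (≤-trans (≤-reflexive (sym m)) (m≤m+n (missing (suc j) s) (upper s (suc j)))))
    ... | inj₂ 1≤u | _      = covered (extend s j 1 h
      (≤-trans 1≤u (m≤n+m (upper s (suc j)) (missing (suc j) s))))
    scan-step (suc j) (forcing h u≡0 e) with zero-or-positive (upper s (2 + j)) | forced-missing j u≡0 e
    -- The forced bottom is the only set missing here, so the deficit of one persists; the top of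
    -- chain `suc j` now forces the next bottom.
    ... | inj₁ v≡0 | m = forcing
      (extend s (suc j) 1 h (≤-trans (≤-reflexive (sym m)) (m≤m+n (missing (2 + j) s) (upper s (2 + j)))))
      v≡0 (inj₂ (upper-0 s (suc j) u≡0 (1 + k′) ≤-refl))
    -- The forced bottom and a gap above it are two missing sets, which repay the deficit.
    ... | inj₂ 1≤v | m = covered (extend s (suc j) 2 h (+-mono-≤ (≤-reflexive (sym m)) 1≤v))

    scan : ∀ j → Scan s j
    scan zero    = covered z≤n
    scan (suc j) = scan-step j (scan j)

    scan-bound : ∀ {j} → Scan s j → j ≤ suc (∑ j (b s ∘ suc))
    scan-bound (covered h)     = m≤n⇒m≤1+n h
    scan-bound (forcing h _ _) = s≤s h

    -- Two laps around the cycle, so that the possible deficit of one is absorbed.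
    interior-window : n ≤ Y s
    interior-window = halve-≤ (≤-trans (scan-bound (scan (n + n))) (≤-reflexive (cong suc two-laps)))
      where
      lap : ∑ n (b s ∘ suc) ≡ Y s
      lap = trans (∑-rotate n (b s) (b-periodic s) 1) (sym (Y≡∑b s))
      two-laps : ∑ (n + n) (b s ∘ suc) ≡ Y s + Y s
      two-laps = trans (∑-split n n (b s ∘ suc)) (cong₂ _+_ lap
        (trans (∑-cong n (λ i _ → trans (cong (b s) (sym (+-suc n i))) (b-periodic s (suc i)))) lap))

  -- Windows containing level `0` or level `n`

  ∑-adjacent : ∀ s c → ∑ n (λ t → b s (c + t) + b s (suc c + t)) ≡ Y s + Y s
  ∑-adjacent s c = trans (∑-+ n (λ t → b s (c + t)) (λ t → b s (suc c + t))) (cong₂ _+_ (rot c) (rot (suc c)))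
    where
    rot : ∀ c → ∑ n (λ t → b s (c + t)) ≡ Y s
    rot c = trans (∑-rotate n (b s) (b-periodic s) c) (sym (Y≡∑b s))

  -- Every chain lies in two adjacent pairs, so one missing set per pair yields only half of `n`.
  half-window : ∀ s c → (∀ t → 1 ≤ b s (c + t) + b s (suc c + t)) → n ≤ Y s + Y s
  half-window s c h = begin
    n             ≡⟨ ∑-one n ⟨
    ∑ n (λ _ → 1) ≤⟨ ∑-mono n (λ t _ → h t) ⟩
    ∑ n (λ t → b s (c + t) + b s (suc c + t)) ≡⟨ ∑-adjacent s c ⟩
    Y s + Y s     ∎
    where open ≤-Reasoning

  positive-pair : ∀ p q → (p ≡ 0 → q ≡ 0 → Empty) → 1 ≤ p + q
  positive-pair zero    zero    h = ⊥-elim (h refl refl)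
  positive-pair zero    (suc q) h = z<s
  positive-pair (suc p) q       h = z<s

  absent-level : ∀ s → (∀ t → f t s ≡ false) → y s ≡ n
  absent-level s h = trans (∑-cong n (λ t _ → cong (λ p → if p then 0 else 1) (h t))) (∑-one n)

  module Bottom (bottom : ∀ t → f t 0 ≡ true) (k≤n : k ≤ n) where

    -- The empty set is the bottom of every chain, so a full chain together with the top of its
    -- neighbour is already a `Y`.
    full-bottom-chain : ∀ t → (∀ i → i ≤ 1 + k′ → f (suc t) (suc i) ≡ true) → missing t (2 + k′) ≡ 1
    full-bottom-chain t full = absent t (2 + k′) λ top →
      noY t 0 k≤n (bottom (2 + t))
        (λ i i≤ → trans (cong (f (suc t)) (+-identityʳ (suc i))) (full i i≤))
        (trans (cong (f t) (+-identityʳ (2 + k′))) top)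

    b0-chain : ∀ t → b 0 t ≡ 0 → ∀ i → i < k → f t i ≡ true
    b0-chain t b≡0 i i<k = trans (cong (f t) (sym (+-identityʳ i))) (b-0 0 t b≡0 i i<k)

    adjacent : ∀ t → 1 ≤ b 0 t + b 0 (suc t)
    adjacent t = positive-pair _ _ λ p q →
      let m≡1 = full-bottom-chain t (λ i i≤ → b0-chain (suc t) q (suc i) (s≤s (s≤s i≤)))
          top = b0-chain t p (2 + k′) ≤-refl
      in 0≢1+n (trans (sym (cong (λ p → if p then 0 else 1) top)) m≡1)

    bottom-window : n ≤ Y 0 + Y 0
    bottom-window = half-window 0 0 adjacent

    -- Equality in bottom-window forces full and top-deficient straight chains to alternate; every
    -- set of level k then lies above a full chain.
    module Tight (tight : Y 0 + Y 0 ≤ n) (k<n : k < n) where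

      adjacent-1 : ∀ t → b 0 t + b 0 (suc t) ≡ 1
      adjacent-1 t = subst (λ u → b 0 u + b 0 (suc u) ≡ 1) (+-identityʳ t)
        (∑-tight n (λ i → b 0 (t + i) + b 0 (suc t + i)) (λ i → adjacent (t + i))
          (≤-trans (≤-reflexive (∑-adjacent 0 t)) tight) 0 0<n)

      zero-side : ∀ p q → p + q ≡ 1 → p ≡ 0 ⊎ q ≡ 0 × p ≡ 1
      zero-side zero          q eq = inj₁ refl
      zero-side (suc zero)    zero eq = inj₂ (refl , refl)

      -- A chain that is not full is followed by a full one and therefore lacks its top. That is its
      -- only missing set, and its level `2 + k′` is above level 1.
      level-1 : ∀ t → f t 1 ≡ true
      level-1 t with zero-side _ _ (adjacent-1 t)
      ... | inj₁ p = b0-chain t p 1 (s≤s (s≤s z≤n))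
      ... | inj₂ (q , p) = present (n≤0⇒n≡0 (s≤s⁻¹ (begin
        suc (missing t 1)                   ≡⟨ +-comm 1 _ ⟩
        missing t 1 + 1                     ≡⟨ cong (missing t 1 +_) m≡1 ⟨
        missing t 1 + missing t (2 + k′)    ≤⟨ +-monoʳ-≤ (missing t 1) top-term ⟩
        missing t 1 + ∑ (1 + k′) (λ i → missing t (2 + i + 0)) ≤⟨ m≤n+m _ (missing t 0) ⟩
        b 0 t                               ≡⟨ p ⟩
        1                                   ∎)))
        where
        open ≤-Reasoning
        m≡1 : missing t (2 + k′) ≡ 1
        m≡1 = full-bottom-chain t (λ i i≤ → b0-chain (suc t) q (suc i) (s≤s (s≤s i≤)))
        top-term : missing t (2 + k′) ≤ ∑ (1 + k′) (λ i → missing t (2 + i + 0))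
        top-term = subst (λ l → missing t l ≤ ∑ (1 + k′) (λ i → missing t (2 + i + 0))) (+-identityʳ (2 + k′))
                     (∑-term (1 + k′) (λ i → missing t (2 + i + 0)) k′ ≤-refl)

      -- One of the chains `suc t` and `2 + t` is full. A set of level `k` above it, with the
      -- neighbouring singleton from `level-1` as second branch, would give a `Y′` on levels `1` to
      -- `k`.
      level-k : ∀ t → missing (suc t) k ≡ 1
      level-k t = absent (suc t) k λ top → contra top (zero-side _ _ (adjacent-1 (suc t)))
        where
        use : ∀ u → suc t ≡ u ⊎ suc t ≡ suc u → f (suc t) k ≡ true → b 0 (suc u) ≡ 0 → Empty
        use u v top full = noY′ (suc t) u 1 v ≤-refl (≤-trans (n≤1+n _) k<n)
          (trans (cong (f (suc t)) (+-comm (2 + k′) 1)) top)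
          (λ i i≤ → trans (cong (f (suc u)) (+-comm i 1)) (b0-chain (suc u) full (suc i) (s≤s (s≤s i≤))))
          (level-1 (2 + u))
        contra : f (suc t) k ≡ true → b 0 (suc t) ≡ 0 ⊎ b 0 (2 + t) ≡ 0 × b 0 (suc t) ≡ 1 → Empty
        contra top (inj₁ p)       = use t (inj₂ refl) top p
        contra top (inj₂ (q , _)) = use (suc t) (inj₁ refl) top q

      y-k : y k ≡ n
      y-k = begin
        ∑ n (λ t → missing t k)       ≡⟨ ∑-rotate n (λ t → missing t k) (missing-periodic k) 1 ⟨
        ∑ n (λ t → missing (suc t) k) ≡⟨ ∑-cong n (λ t _ → level-k t) ⟩
        ∑ n (λ _ → 1)                 ≡⟨ ∑-one n ⟩
        n                             ∎
        where open ≡-Reasoning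

      -- Level `k` alone contributes `n`. The levels `1` to `k − 1` add at least one, because `Y 0`
      -- is positive and `y 0` vanishes.
      second-window : suc n ≤ Y 1
      second-window = begin
        suc n                                    ≤⟨ +-monoˡ-≤ n 1≤∑ ⟩
        ∑ (2 + k′) (λ i → y (suc i + 0)) + n     ≡⟨ cong₂ _+_ (∑-cong (2 + k′) (λ i _ → cong y (shift i)))
                                                      (trans (sym y-k) (cong y (+-comm 1 (2 + k′)))) ⟩
        ∑ (2 + k′) (λ i → y (i + 1)) + y (2 + k′ + 1) ≡⟨ ∑-last (2 + k′) (λ i → y (i + 1)) ⟨
        Y 1                                      ∎
        where
        open ≤-Reasoning
        shift : ∀ i → suc i + 0 ≡ i + 1
        shift i = trans (+-identityʳ (suc i)) (+-comm 1 i)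
        y-0 : y 0 ≡ 0
        y-0 = ∑-zero n (λ t _ → cong (λ p → if p then 0 else 1) (bottom t))
        1≤∑ : 1 ≤ ∑ (2 + k′) (λ i → y (suc i + 0))
        1≤∑ with zero-or-positive (∑ (2 + k′) (λ i → y (suc i + 0)))
        ... | inj₂ 1≤  = 1≤
        ... | inj₁ ≡0 = ⊥-elim (n≮0 (≤-trans 0<n (≤-trans bottom-window
                (≤-reflexive (cong (λ m → m + m) (cong₂ _+_ y-0 ≡0))))))

  module Top (top : ∀ t → f t n ≡ true) (k≤n : k ≤ n) where

    s : ℕ
    s = n ∸ (2 + k′)

    s+ : s + (2 + k′) ≡ n
    s+ = m∸n+n≡m (≤-trans (n≤1+n _) k≤n)

    -- Since `[n]` lies on top of every chain, a full chain and the bottom of the next one already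
    -- give a `Y′`.
    top-window : n ≤ Y s + Y s
    top-window = half-window s 1 λ t → positive-pair _ _ λ p q →
      noY′ t t s (inj₁ refl) (m<n⇒0<n∸m k≤n) (≤-reflexive s+)
        (trans (cong (f t) (trans (+-comm (2 + k′) s) s+)) (top t))
        (λ i i≤ → b-0 s (1 + t) p i (≤-trans (s≤s i≤) (n≤1+n _)))
        (b-0 s (2 + t) q 0 z<s)

-- Intervals along a cyclic permutation

∣⁅x⁆∪p∣ : ∀ {n} (x : Fin n) (p : Subset n) → x ∉ p → ∣ ⁅ x ⁆ ∪ p ∣ ≡ suc ∣ p ∣
∣⁅x⁆∪p∣ zero    (true  ∷ p) x∉p = ⊥-elim (x∉p here)
∣⁅x⁆∪p∣ zero    (false ∷ p) x∉p = cong (suc ∘ ∣_∣) (∪-identityˡ p)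
∣⁅x⁆∪p∣ (suc x) (true  ∷ p) x∉p = cong suc (∣⁅x⁆∪p∣ x p (x∉p ∘ there))
∣⁅x⁆∪p∣ (suc x) (false ∷ p) x∉p = ∣⁅x⁆∪p∣ x p (x∉p ∘ there)

-- Once the equal remainders cancel, `d` is a difference of multiples of `n`, hence a multiple of
-- `n` below `n`.
%-cancel-< : ∀ n .{{_ : NonZero n}} u d → d < n → (u + d) % n ≡ u % n → d ≡ 0
%-cancel-< n u d d<n eq = begin
  d                          ≡⟨ m<n⇒m%n≡m d<n ⟨
  d % n                      ≡⟨ [m+kn]%n≡m%n d (u / n) n ⟨
  (d + (u / n) * n) % n      ≡⟨ cong (_% n) d+qn≡Qn ⟩
  ((u + d) / n * n) % n      ≡⟨ m*n%n≡0 ((u + d) / n) n ⟩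
  0                          ∎
  where
  open ≡-Reasoning
  d+qn≡Qn : d + (u / n) * n ≡ (u + d) / n * n
  d+qn≡Qn = +-cancelˡ-≡ (u % n) _ _ (begin
    u % n + (d + (u / n) * n)        ≡⟨ rearrange (u % n) d ((u / n) * n) ⟩
    u % n + (u / n) * n + d          ≡⟨ cong (_+ d) (m≡m%n+[m/n]*n u n) ⟨
    u + d                            ≡⟨ m≡m%n+[m/n]*n (u + d) n ⟩
    (u + d) % n + (u + d) / n * n    ≡⟨ cong (_+ (u + d) / n * n) eq ⟩
    u % n + (u + d) / n * n          ∎)
    where
    rearrange : ∀ a b c → a + (b + c) ≡ a + c + b
    rearrange = solve-∀

module Cycle {n : ℕ} .{{_ : NonZero n}} (σ : Permutation′ n) where

  e : ℕ → Fin n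
  e u = σ ⟨$⟩ʳ fromℕ< (m%n<n u n)

  e-periodic : ∀ u → e (n + u) ≡ e u
  e-periodic u = cong (σ ⟨$⟩ʳ_) (fromℕ<-cong _ _ (trans (cong (_% n) (+-comm n u)) ([m+n]%n≡m%n u n)) _ _)

  e-injective : ∀ u d → d < n → e (u + d) ≡ e u → d ≡ 0
  e-injective u d d<n eq = %-cancel-< n u d d<n
    (fromℕ<-injective _ _ (m%n<n (u + d) n) (m%n<n u n) (Injection.injective (↔⇒↣ σ) eq))

  -- The intervals of the statement, with a starting point in `ℕ` so that neighbours are `t` and
  -- `suc t` without wrapping around.
  arc : ℕ → ℕ → Subset n
  arc t zero    = ⊥
  arc t (suc s) = ⁅ e (suc t) ⁆ ∪ arc (suc t) s

  arc-interval : ∀ t s → interval σ t s ≡ arc (toℕ t) s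
  arc-interval t s = go id (toℕ t) s (λ j → refl)
    where
    -- `upTo` unfolds to `applyUpTo` with ever more shifted functions, so the induction runs over an
    -- arbitrary `g` and start `t′`.
    go : ∀ (g : ℕ → ℕ) t′ s → (∀ j → toℕ t + suc (g j) ≡ t′ + suc j) →
         foldr (λ j acc → ⁅ e (toℕ t + suc j) ⁆ ∪ acc) ⊥ (applyUpTo g s) ≡ arc t′ s
    go g t′ zero    h = refl
    go g t′ (suc s) h = cong₂ (λ u p → ⁅ e u ⁆ ∪ p) (trans (h 0) (+-comm t′ 1))
      (go (g ∘ suc) (suc t′) s (λ j → trans (h (suc j)) (+-suc t′ (suc j))))

  arc-periodic : ∀ t s → arc (n + t) s ≡ arc t s
  arc-periodic t zero    = refl
  arc-periodic t (suc s) = cong₂ (λ x p → ⁅ x ⁆ ∪ p)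
    (trans (cong e (sym (+-suc n t))) (e-periodic (suc t)))
    (trans (cong (λ t → arc t s) (sym (+-suc n t))) (arc-periodic (suc t) s))

  ∈-head : ∀ t s → e (suc t) ∈ arc t (suc s)
  ∈-head t s = x∈p∪q⁺ (inj₁ (x∈⁅x⁆ (e (suc t))))

  tail-⊆ : ∀ t s → arc (suc t) s ⊆ arc t (suc s)
  tail-⊆ t s = q⊆p∪q ⁅ e (suc t) ⁆ (arc (suc t) s)

  init-⊆ : ∀ t s → arc t s ⊆ arc t (suc s)
  init-⊆ t zero    x∈ = ⊥-elim (∉⊥ x∈)
  init-⊆ t (suc s) x∈ with x∈p∪q⁻ ⁅ e (suc t) ⁆ (arc (suc t) s) x∈
  ... | inj₁ x∈h = x∈p∪q⁺ (inj₁ x∈h)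
  ... | inj₂ x∈t = x∈p∪q⁺ (inj₂ (init-⊆ (suc t) s x∈t))

  ∈-last : ∀ t s → e (suc s + t) ∈ arc t (suc s)
  ∈-last t zero    = ∈-head t 0
  ∈-last t (suc s) = tail-⊆ t (suc s) (subst (λ u → e u ∈ arc (suc t) (suc s)) (+-suc (suc s) t) (∈-last (suc t) s))

  -- The last position of the arc is `s + u` steps after `t`, less than a full turn. Removing the
  -- head trades one unit of `s` for one of `u`.
  ∉-before : ∀ t u s → s + u < n → e t ∉ arc (u + t) s
  ∉-before t u zero    lt x∈ = ∉⊥ x∈
  ∉-before t u (suc s) lt x∈ with x∈p∪q⁻ ⁅ e (suc u + t) ⁆ (arc (suc u + t) s) x∈
  ... | inj₁ x∈h = 1+n≢0 (e-injective t (suc u) (≤-<-trans (s≤s (m≤n+m u s)) lt)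
                     (trans (cong e (+-comm t (suc u))) (sym (x∈⁅y⁆⇒x≡y _ x∈h))))
  ... | inj₂ x∈t = ∉-before t (suc u) s (subst (_< n) (sym (+-suc s u)) lt) x∈t

  ∉-after : ∀ t s → s < n → e (suc s + t) ∉ arc t s
  ∉-after t zero    lt x∈ = ∉⊥ x∈
  ∉-after t (suc s) lt x∈ with x∈p∪q⁻ ⁅ e (suc t) ⁆ (arc (suc t) s) x∈
  ... | inj₁ x∈h = 1+n≢0 (e-injective (suc t) (suc s) lt
                     (trans (cong e (trans (+-comm (suc t) (suc s)) (+-suc (suc s) t))) (x∈⁅y⁆⇒x≡y _ x∈h)))
  ... | inj₂ x∈t = ∉-after (suc t) s (<-trans (n<1+n s) lt)
                     (subst (λ u → e u ∈ arc (suc t) s) (sym (+-suc (suc s) t)) x∈t)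

  ∣arc∣ : ∀ t s → s ≤ n → ∣ arc t s ∣ ≡ s
  ∣arc∣ t zero    s≤n = ∣⊥∣≡0 n
  ∣arc∣ t (suc s) s<n = trans
    (∣⁅x⁆∪p∣ (e (suc t)) (arc (suc t) s) (∉-before (suc t) 0 s (subst (_< n) (sym (+-identityʳ s)) s<n)))
    (cong suc (∣arc∣ (suc t) s (<⇒≤ s<n)))

  arc-n : ∀ t → arc t n ≡ ⊤
  arc-n t = ∣p∣≡n⇒p≡⊤ (∣arc∣ t n ≤-refl)

  tail-⊂ : ∀ t s → s < n → arc (suc t) s ⊂ arc t (suc s)
  tail-⊂ t s s<n = tail-⊆ t s , e (suc t) , ∈-head t s ,
    ∉-before (suc t) 0 s (subst (_< n) (sym (+-identityʳ s)) s<n)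

  init-⊂ : ∀ t s → s < n → arc t s ⊂ arc t (suc s)
  init-⊂ t s s<n = init-⊆ t s , e (suc s + t) , ∈-last t s , ∉-after t s s<n

  arc-≢ : ∀ t s → 1 ≤ s → s < n → arc t s ≢ arc (suc t) s
  arc-≢ t (suc s) _ lt eq = ∉-before (suc t) 0 (suc s) (subst (_< n) (sym (+-identityʳ (suc s))) lt)
    (subst (e (suc t) ∈_) eq (∈-head t s))

  module _ (𝓕 : Family n) (k′ : ℕ) where

    private
      k = 3 + k′

      ≢-by-size : ∀ {p q : Subset n} {a b} → ∣ p ∣ ≡ a → ∣ q ∣ ≡ b → a ≢ b → p ≢ q
      ≢-by-size pa qb a≢b p≡q = a≢b (trans (sym pa) (trans (cong ∣_∣ p≡q) qb))

    -- The branches are the two arcs of size `s + k − 1` starting after `1 + t` and `t`; they differ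
    -- because this size is below `n`.
    no-arc-Y : ¬ CopyY k 𝓕 → ∀ t s → s + k ≤ n → 𝓕 (arc (2 + t) s) ≡ true →
               (∀ i → i ≤ 1 + k′ → 𝓕 (arc (1 + t) (suc i + s)) ≡ true) →
               𝓕 (arc t (2 + k′ + s)) ≡ true → Empty
    no-arc-Y ¬Y t s s+k≤n bottom middle top = ¬Y record
      { F₁ = arc (1 + t) (2 + k′ + s)
      ; F₂ = arc t (2 + k′ + s)
      ; G = G
      ; F₁∈ = middle (1 + k′) ≤-refl
      ; F₂∈ = top
      ; G∈ = G∈
      ; F₁≢F₂ = λ eq → arc-≢ t (2 + k′ + s) z<s K<n (sym eq)
      ; G≢G = λ { (suc i) (suc j) _ i≤ _ j≤ i≢j → ≢-by-size (∣G∣ i i≤) (∣G∣ j j≤) (λ eq → i≢j (cong suc (+-cancelʳ-≡ s i j eq))) }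
      ; G≢F₁ = λ { (suc i) _ i≤ → ≢-by-size (∣G∣ i i≤) (∣F∣ (1 + t)) (λ eq → <⇒≢ i≤ (+-cancelʳ-≡ s i _ eq)) }
      ; G≢F₂ = λ { (suc i) _ i≤ → ≢-by-size (∣G∣ i i≤) (∣F∣ t) (λ eq → <⇒≢ i≤ (+-cancelʳ-≡ s i _ eq)) }
      ; chain = chain
      ; top₁ = init-⊂ (1 + t) (1 + k′ + s) (<-trans (n<1+n _) K<n)
      ; top₂ = tail-⊂ t (1 + k′ + s) (<-trans (n<1+n _) K<n)
      ; size₁₂ = trans (∣F∣ (1 + t)) (sym (∣F∣ t))
      ; sizeG = λ { (suc i) _ i≤ → trans (∣F∣ (1 + t)) (trans (size-sum i i≤) (cong (_+ (2 + k′ ∸ i)) (sym (∣G∣ i i≤)))) }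
      }
      where
      K<n : 2 + k′ + s < n
      K<n = subst (_≤ n) (+-comm s k) s+k≤n
      -- The stem is indexed from 1, so `G 0` is a default value; `G 1` is the bent bottom.
      G : ℕ → Subset n
      G zero          = ⊥
      G (suc zero)    = arc (2 + t) s
      G (suc (suc i)) = arc (1 + t) (suc i + s)
      G∈ : ∀ i → 1 ≤ i → i ≤ 2 + k′ → 𝓕 (G i) ≡ true
      G∈ (suc zero)    _ _         = bottom
      G∈ (suc (suc i)) _ (s≤s i<) = middle i (<⇒≤ i<)
      ∣F∣ : ∀ t → ∣ arc t (2 + k′ + s) ∣ ≡ 2 + k′ + s
      ∣F∣ t = ∣arc∣ t (2 + k′ + s) (<⇒≤ K<n)
      ≤n : ∀ {i} → i ≤ 2 + k′ → i + s ≤ n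
      ≤n i≤ = ≤-trans (+-monoˡ-≤ s i≤) (<⇒≤ K<n)
      ∣G∣ : ∀ i → suc i ≤ 2 + k′ → ∣ G (suc i) ∣ ≡ i + s
      ∣G∣ zero    i≤ = ∣arc∣ (2 + t) s (≤n {0} z≤n)
      ∣G∣ (suc i) i≤ = ∣arc∣ (1 + t) (suc i + s) (≤n (<⇒≤ i≤))
      chain : ∀ i → 1 ≤ i → suc i ≤ 2 + k′ → G i ⊂ G (suc i)
      chain (suc zero)    _ i≤ = tail-⊂ (1 + t) s (≤n (≤-trans (n≤1+n 1) i≤))
      chain (suc (suc i)) _ i≤ = init-⊂ (1 + t) (suc i + s) (≤n (≤-trans (n≤1+n _) i≤))
      size-sum : ∀ i → suc i ≤ 2 + k′ → 2 + k′ + s ≡ i + s + (2 + k′ ∸ i)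
      size-sum i i≤ = trans (cong (_+ s) (sym (m+[n∸m]≡n (<⇒≤ i≤)))) (swap i (2 + k′ ∸ i) s)
        where
        swap : ∀ a b c → a + b + c ≡ a + c + b
        swap = solve-∀

    -- Both admissible tops contain the next stem arc, as a tail or as an initial piece. The stem is
    -- listed downwards, and `1 ≤ s` separates the two branches at the bottom.
    no-arc-Y′ : ¬ CopyY′ k 𝓕 → ∀ v t s → v ≡ t ⊎ v ≡ suc t → 1 ≤ s → s + (2 + k′) ≤ n →
                𝓕 (arc v (2 + k′ + s)) ≡ true →
                (∀ i → i ≤ 1 + k′ → 𝓕 (arc (1 + t) (i + s)) ≡ true) →
                𝓕 (arc (2 + t) s) ≡ true → Empty
    no-arc-Y′ ¬Y′ v t s v≡ 1≤s s+k≤n top middle bottom = ¬Y′ record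
      { F₁ = arc (1 + t) s
      ; F₂ = arc (2 + t) s
      ; G = G
      ; F₁∈ = middle 0 z≤n
      ; F₂∈ = bottom
      ; G∈ = G∈
      ; F₁≢F₂ = arc-≢ (1 + t) s 1≤s (≤n {1} (s≤s z≤n))
      ; G≢G = λ { (suc i) (suc j) _ i≤ _ j≤ i≢j → ≢-by-size (∣G∣ i i≤) (∣G∣ j j≤)
                (λ eq → i≢j (cong suc (∸-cancelˡ-≡ (<⇒≤ i≤) (<⇒≤ j≤) (+-cancelʳ-≡ s _ _ eq)))) }
      ; G≢F₁ = λ { (suc i) _ i≤ → ≢-by-size (∣G∣ i i≤) (∣F∣ (1 + t)) (λ eq → m<n⇒n∸m≢0 i≤ (+-cancelʳ-≡ s _ 0 eq)) }
      ; G≢F₂ = λ { (suc i) _ i≤ → ≢-by-size (∣G∣ i i≤) (∣F∣ (2 + t)) (λ eq → m<n⇒n∸m≢0 i≤ (+-cancelʳ-≡ s _ 0 eq)) }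
      ; chain = chain
      ; top₁ = subst (arc (1 + t) s ⊂_) (sym G-last) (init-⊂ (1 + t) s (≤n {1} (s≤s z≤n)))
      ; top₂ = subst (arc (2 + t) s ⊂_) (sym G-last) (tail-⊂ (1 + t) s (≤n {1} (s≤s z≤n)))
      ; size₁₂ = trans (∣F∣ (1 + t)) (sym (∣F∣ (2 + t)))
      ; sizeG = λ { (suc i) _ i≤ → trans (∣G∣ i i≤) (trans (+-comm (2 + k′ ∸ i) s) (cong (_+ (2 + k′ ∸ i)) (sym (∣F∣ (1 + t))))) }
      }
      where
      K≤n : 2 + k′ + s ≤ n
      K≤n = subst (_≤ n) (+-comm s (2 + k′)) s+k≤n
      ≤n : ∀ {i} → i ≤ 2 + k′ → i + s ≤ n
      ≤n i≤ = ≤-trans (+-monoˡ-≤ s i≤) K≤n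
      m<n⇒n∸m≢0 : ∀ {m n} → m < n → n ∸ m ≢ 0
      m<n⇒n∸m≢0 lt eq = <⇒≢ (m<n⇒0<n∸m lt) (sym eq)
      G : ℕ → Subset n
      G zero          = ⊥
      G (suc zero)    = arc v (2 + k′ + s)
      G (suc (suc i)) = arc (1 + t) (1 + k′ ∸ i + s)
      G∈ : ∀ i → 1 ≤ i → i ≤ 2 + k′ → 𝓕 (G i) ≡ true
      G∈ (suc zero)    _ _        = top
      G∈ (suc (suc i)) _ (s≤s i<) = middle (1 + k′ ∸ i) (m∸n≤m (1 + k′) i)
      G-last : G (2 + k′) ≡ arc (1 + t) (suc s)
      G-last = cong (λ i → arc (1 + t) (i + s)) (trans (+-∸-assoc 1 {k′} ≤-refl) (cong suc (n∸n≡0 k′)))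
      ∣F∣ : ∀ t → ∣ arc t s ∣ ≡ s
      ∣F∣ t = ∣arc∣ t s (≤n {0} z≤n)
      ∣G∣ : ∀ i → suc i ≤ 2 + k′ → ∣ G (suc i) ∣ ≡ 2 + k′ ∸ i + s
      ∣G∣ zero    i≤ = ∣arc∣ v (2 + k′ + s) K≤n
      ∣G∣ (suc i) i≤ = ∣arc∣ (1 + t) (1 + k′ ∸ i + s) (≤n (≤-trans (m∸n≤m (1 + k′) i) (n≤1+n _)))
      G₂⊂G₁ : ∀ {v} → v ≡ t ⊎ v ≡ suc t → arc (1 + t) (1 + k′ + s) ⊂ arc v (2 + k′ + s)
      G₂⊂G₁ (inj₁ refl) = tail-⊂ t (1 + k′ + s) K≤n
      G₂⊂G₁ (inj₂ refl) = init-⊂ (1 + t) (1 + k′ + s) K≤n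
      chain : ∀ i → 1 ≤ i → suc i ≤ 2 + k′ → G (suc i) ⊂ G i
      chain (suc zero) _ i≤ = G₂⊂G₁ v≡
      chain (suc (suc i)) _ (s≤s (s≤s i≤)) = subst (λ l → arc (1 + t) (k′ ∸ i + s) ⊂ arc (1 + t) (l + s)) (sym (+-∸-assoc 1 {k′} (<⇒≤ i≤)))
        (init-⊂ (1 + t) (k′ ∸ i + s) (≤n {suc (k′ ∸ i)} (s≤s (≤-trans (m∸n≤m k′ i) (n≤1+n _)))))

-- Binomial coefficients summed over residue classes

nC0≡1 : ∀ n → n C 0 ≡ 1
nC0≡1 n = trans (nCk≡nC[n∸k] {0} {n} z≤n) (nCn≡1 n)

nCk≡nCj : ∀ n k j → k + j ≡ n → n C k ≡ n C j
nCk≡nCj n k j refl = trans (nCk≡nC[n∸k] (m≤m+n k j)) (cong (n C_) (m+n∸m≡n k j))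

-- Pascal's rule reduces the claim to comparing the entries `j` and `2 + j` of the previous row.
-- They are either mirror images or two inductive steps apart.
C-mono : ∀ n j → suc (j + j) ≤ n → n C j ≤ n C suc j
C-mono (suc n) zero    h = subst₂ _≤_ (sym (nC0≡1 (suc n))) (sym (nC1≡n (suc n))) z<s
C-mono (suc n) (suc j) h = begin
  suc n C suc j               ≡⟨ nCk+nC[k+1]≡[n+1]C[k+1] n j ⟨
  n C j + n C suc j           ≡⟨ +-comm (n C j) _ ⟩
  n C suc j + n C j           ≤⟨ +-monoʳ-≤ (n C suc j) two-steps ⟩
  n C suc j + n C (2 + j)     ≡⟨ nCk+nC[k+1]≡[n+1]C[k+1] n (suc j) ⟩
  suc n C (2 + j)             ∎
  where
  open ≤-Reasoning
  double : j + (2 + j) ≡ suc j + suc j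
  double = +-suc j (suc j)
  two-steps : n C j ≤ n C (2 + j)
  two-steps with m≤n⇒m<n∨m≡n (s≤s⁻¹ h)
  ... | inj₂ eq = ≤-reflexive (nCk≡nCj n j (2 + j) (trans double eq))
  ... | inj₁ lt = ≤-trans (C-mono n j (≤-trans (s≤s (+-monoʳ-≤ j (n≤1+n j))) (<⇒≤ lt)))
                          (C-mono n (suc j) lt)

C-positive : ∀ n j → j ≤ n → 1 ≤ n C j
C-positive n       zero    _         = ≤-reflexive (sym (nC0≡1 n))
C-positive (suc n) (suc j) (s≤s j≤n) = ≤-trans (C-positive n j j≤n)
  (≤-trans (m≤m+n (n C j) _) (≤-reflexive (nCk+nC[k+1]≡[n+1]C[k+1] n j)))

C-interior : ∀ n j → suc j < n → n ≤ n C suc j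
C-interior (suc n) zero    _          = ≤-reflexive (sym (nC1≡n (suc n)))
C-interior (suc n) (suc j) (s≤s lt) = begin
  suc n                       ≡⟨ +-comm 1 n ⟩
  n + 1                       ≤⟨ +-mono-≤ (C-interior n j lt) (C-positive n (2 + j) lt) ⟩
  n C suc j + n C (2 + j)     ≡⟨ nCk+nC[k+1]≡[n+1]C[k+1] n (suc j) ⟩
  suc n C (2 + j)             ∎
  where open ≤-Reasoning

-- Pascal's rule summed under an additive weight `h`, which serves both the full row sum and the
-- sums over a residue class.
∑-C-suc : ∀ n (h : ℕ → ℕ → ℕ) → (∀ i v w → h i (v + w) ≡ h i v + h i w) → (∀ i → h i 0 ≡ 0) →
  ∑ (2 + n) (λ i → h i (suc n C i)) ≡ ∑ (suc n) (λ i → h i (n C i)) + ∑ (suc n) (λ i → h (suc i) (n C i))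
∑-C-suc n h additive zeros = begin
  h 0 (suc n C 0) + ∑ (suc n) (λ i → h (suc i) (suc n C suc i))
    ≡⟨ cong₂ _+_ (cong (h 0) (trans (nC0≡1 (suc n)) (sym (nC0≡1 n)))) (trans (∑-cong (suc n) (λ i _ → trans (cong (h (suc i))
         (trans (sym (nCk+nC[k+1]≡[n+1]C[k+1] n i)) (+-comm (n C i) (n C suc i)))) (additive (suc i) (n C suc i) (n C i))))
         (∑-+ (suc n) (λ i → h (suc i) (n C suc i)) (λ i → h (suc i) (n C i)))) ⟩
  h 0 (n C 0) + (∑ (suc n) (λ i → h (suc i) (n C suc i)) + ∑ (suc n) (λ i → h (suc i) (n C i)))
    ≡⟨ cong (λ x → h 0 (n C 0) + (x + ∑ (suc n) (λ i → h (suc i) (n C i)))) (trans (∑-last n (λ i → h (suc i) (n C suc i)))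
         (trans (cong (∑ n (λ i → h (suc i) (n C suc i)) +_) (trans (cong (h (suc n)) (k>n⇒nCk≡0 (n<1+n n))) (zeros (suc n)))) (+-identityʳ _))) ⟩
  h 0 (n C 0) + (∑ n (λ i → h (suc i) (n C suc i)) + ∑ (suc n) (λ i → h (suc i) (n C i)))
    ≡⟨ +-assoc (h 0 (n C 0)) _ _ ⟨
  ∑ (suc n) (λ i → h i (n C i)) + ∑ (suc n) (λ i → h (suc i) (n C i)) ∎
  where open ≡-Reasoning

∑-C : ∀ n → ∑ (suc n) (n C_) ≡ 2 ^ n
∑-C zero    = refl
∑-C (suc n) = trans (∑-C-suc n (λ _ v → v) (λ _ _ _ → refl) (λ _ → refl))
  (trans (cong₂ _+_ (∑-C n) (∑-C n)) (cong (2 ^ n +_) (sym (+-identityʳ (2 ^ n)))))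

module Residues (k₁ : ℕ) where

  k : ℕ
  k = suc k₁

  infix 4 _≡ₖ_
  _≡ₖ_ : ℕ → ℕ → Set
  i ≡ₖ r = i % k ≡ r % k

  +-congₖ : ∀ c a b → a ≡ₖ b → c + a ≡ₖ c + b
  +-congₖ c a b eq = trans (%-distribˡ-+ c a k)
    (trans (cong (λ x → (c % k + x) % k) eq) (sym (%-distribˡ-+ c b k)))

  -- Modulo `k = suc k₁` the number `c * k₁` is the negative of `c`.
  drop-multiple : ∀ c a → c * k₁ + (c + a) ≡ₖ a
  drop-multiple c a = trans (cong (_% k) (rearrange c a k₁)) ([m+kn]%n≡m%n a c k)
    where
    rearrange : ∀ c a k₁ → c * k₁ + (c + a) ≡ a + c * suc k₁
    rearrange = solve-∀

  +-cancelₖ : ∀ c a b → c + a ≡ₖ c + b → a ≡ₖ b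
  +-cancelₖ c a b eq = trans (sym (drop-multiple c a)) (trans (+-congₖ (c * k₁) (c + a) (c + b) eq) (drop-multiple c b))

  +k : ∀ a → k + a ≡ₖ a
  +k a = trans (cong (_% k) (+-comm k a)) ([m+n]%n≡m%n a k)

  sel : ℕ → ℕ → ℕ → ℕ
  sel i r v = if ⌊ i % k ≟ r % k ⌋ then v else 0

  sel-cong : ∀ i r j q v → (i ≡ₖ r → j ≡ₖ q) → (j ≡ₖ q → i ≡ₖ r) → sel i r v ≡ sel j q v
  sel-cong i r j q v f g with i % k ≟ r % k | j % k ≟ q % k
  ... | yes _ | yes _ = refl
  ... | yes p | no ¬q = ⊥-elim (¬q (f p))
  ... | no ¬p | yes q = ⊥-elim (¬p (g q))
  ... | no _  | no _  = refl

  sel-shift : ∀ c i r v → sel (c + i) (c + r) v ≡ sel i r v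
  sel-shift c i r v = sel-cong (c + i) (c + r) i r v (+-cancelₖ c i r) (+-congₖ c i r)

  sel-residue : ∀ i r q v → r ≡ₖ q → sel i r v ≡ sel i q v
  sel-residue i r q v eq = sel-cong i r i q v (λ p → trans p eq) (λ p → trans p (sym eq))

  complement : ∀ i j r q → i + j ≡ₖ r + q → i ≡ₖ r → j ≡ₖ q
  complement i j r q eq p = +-cancelₖ i j q (trans eq
    (trans (cong (_% k) (+-comm r q)) (trans (sym (+-congₖ q i r p)) (cong (_% k) (+-comm q i)))))

  sel-reflect : ∀ i j r q v → i + j ≡ₖ r + q → sel i r v ≡ sel j q v
  sel-reflect i j r q v eq = sel-cong i r j q v (complement i j r q eq)
    (complement j i q r (trans (cong (_% k) (+-comm j i)) (trans eq (cong (_% k) (+-comm r q)))))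

  sel-refl : ∀ i v → sel i i v ≡ v
  sel-refl i v with i % k ≟ i % k
  ... | yes _ = refl
  ... | no ¬p = ⊥-elim (¬p refl)

  sel-no : ∀ i r v → ¬ (i ≡ₖ r) → sel i r v ≡ 0
  sel-no i r v ¬p with i % k ≟ r % k
  ... | yes p = ⊥-elim (¬p p)
  ... | no _  = refl

  sel-yes : ∀ i r v → 1 ≤ sel i r v → i ≡ₖ r
  sel-yes i r v 1≤ with i % k ≟ r % k
  ... | yes p = p

  sel-between : ∀ {j i} v → j < i → i < k + j → sel j i v ≡ 0
  sel-between {j} {i} v j<i i<k+j = sel-no j i v λ j≡i → <⇒≢ (m<n⇒0<n∸m j<i) (sym
    (%-cancel-< k j (i ∸ j) (+-cancelʳ-< j (i ∸ j) k (subst (_< k + j) (sym (m∸n+n≡m (<⇒≤ j<i))) i<k+j))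
      (trans (cong (_% k) (m+[n∸m]≡n (<⇒≤ j<i))) (sym j≡i))))

  sel-mono : ∀ i r {v w} → v ≤ w → sel i r v ≤ sel i r w
  sel-mono i r v≤w with i % k ≟ r % k
  ... | yes _ = v≤w
  ... | no _  = z≤n

  sel-≤ : ∀ i r v → sel i r v ≤ v
  sel-≤ i r v with i % k ≟ r % k
  ... | yes _ = ≤-refl
  ... | no _  = z≤n

  sel-+ : ∀ i r v w → sel i r (v + w) ≡ sel i r v + sel i r w
  sel-+ i r v w with i % k ≟ r % k
  ... | yes _ = refl
  ... | no _  = refl

  sel-0 : ∀ i r → sel i r 0 ≡ 0
  sel-0 i r with i % k ≟ r % k
  ... | yes _ = refl
  ... | no _  = refl

  -- This is `S n k r`, in the form to which the lemmas on `∑` apply.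
  T : ℕ → ℕ → ℕ
  T n r = ∑ (suc n) (λ i → sel i r (n C i))

  T-pascal : ∀ n r → T (suc n) (suc r) ≡ T n (suc r) + T n r
  T-pascal n r = trans
    (∑-C-suc n (λ i → sel i (suc r)) (λ i → sel-+ i (suc r)) (λ i → sel-0 i (suc r)))
    (cong (T n (suc r) +_) (∑-cong (suc n) (λ i _ → sel-shift 1 i r (n C i))))

  T-reflect : ∀ n r q → r + q ≡ₖ n → T n r ≡ T n q
  T-reflect n r q eq = ∑-reverse (suc n) {λ i → sel i r (n C i)} {λ i → sel i q (n C i)} λ i i<sn →
    let n-i+i = m∸n+n≡m (s≤s⁻¹ i<sn) in
    trans (cong (sel (n ∸ i) r) (nCk≡nCj n (n ∸ i) i n-i+i))
          (sel-reflect (n ∸ i) i r q (n C i) (trans (cong (_% k) n-i+i) (sym eq)))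

  T-periodic : ∀ n r → T n (k + r) ≡ T n r
  T-periodic n r = ∑-cong (suc n) (λ i _ → sel-residue i (k + r) r (n C i) (+k r))

  -- Unimodality of the residue class sums

  module Unimodal (1≤k₁ : 1 ≤ k₁) where

    +2ck : ∀ n c → n + (c * k + c * k) ≡ₖ n
    +2ck n c = trans (cong (λ x → (n + x) % k) (sym (*-distribʳ-+ k c c))) ([m+kn]%n≡m%n n (c + c) k)

    -- The cyclic sequence r ↦ T n r is symmetric about n / 2 and nondecreasing on the half period
    -- before it; c selects the period.
    T-mono : ∀ n a c → n + (c * k + c * k) ≤ suc (a + a) + k → suc (a + a) ≤ n + (c * k + c * k) →
             T n a ≤ T n (suc a)
    T-mono-suc : ∀ n a c → suc n + (c * k + c * k) ≤ suc (suc a + suc a) + k →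
                 suc (suc a + suc a) ≤ suc n + (c * k + c * k) →
                 T (suc n) (suc a) ≤ T (suc n) (2 + a)

    T-mono zero a c h₁ h₂ with zero-or-positive (sel 0 a 1)
    ... | inj₁ s≡0 = ≤-trans (≤-reflexive (trans (+-identityʳ (sel 0 a 1)) s≡0)) z≤n
    -- Here `a` is a multiple of `k` below `c * k`, hence at most `(c − 1) * k`; since `k` is at
    -- least 2, this is too small for `h₁`.
    ... | inj₂ 1≤s = ⊥-elim (<⇒≱ (s≤s 1≤k₁) (≤-certificate 0 (≤-trans (+-mono-≤ k+a≤ck k+a≤ck) h₁) (rearrange k a)))
      where
      rearrange : ∀ k a → suc (a + a) + k + k + 0 ≡ k + a + (k + a) + 1
      rearrange = solve-∀
      a≡qk : a ≡ a / k * k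
      a≡qk = trans (m≡m%n+[m/n]*n a k) (cong (_+ a / k * k) (sym (sel-yes 0 a 1 1≤s)))
      a<ck : a < c * k
      a<ck = ≰⇒> λ ck≤a → <⇒≱ h₂ (+-mono-≤ ck≤a ck≤a)
      k+a≤ck : k + a ≤ c * k
      k+a≤ck = subst (λ x → k + x ≤ c * k) (sym a≡qk)
        (*-monoˡ-≤ k (*-cancelʳ-< k (a / k) c (subst (_< c * k) a≡qk a<ck)))
    -- Pascal's rule needs a predecessor of the residue, so `0` is replaced by `k` and the period
    -- `c` by `suc c`.
    T-mono (suc n) zero c h₁ h₂ = subst₂ _≤_ (trans (cong (T (suc n)) (sym (+-identityʳ k))) (T-periodic (suc n) 0))
      (trans (cong (T (suc n)) (+-comm 1 k)) (T-periodic (suc n) 1))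
      (T-mono-suc n k₁ (suc c)
         (≤-certificate 0 h₁ (rearrange₁ n (c * k) k))
         (≤-certificate 0 h₂ (rearrange₂ n (c * k) k)))
      where
      rearrange₁ : ∀ n x k → 1 + k + (suc n + (k + x + (k + x))) + 0 ≡ suc n + (x + x) + (suc (k + k) + k)
      rearrange₁ = solve-∀
      rearrange₂ : ∀ n x k → suc n + (x + x) + suc (k + k) + 0 ≡ 1 + (suc n + (k + x + (k + x)))
      rearrange₂ = solve-∀
    T-mono (suc n) (suc a) c h₁ h₂ = T-mono-suc n a c h₁ h₂

    T-mono-suc n a c h₁ h₂ = begin
      T (suc n) (suc a)         ≡⟨ T-pascal n a ⟩
      T n (suc a) + T n a       ≤⟨ +-monoʳ-≤ (T n (suc a)) two-steps ⟩
      T n (suc a) + T n (2 + a) ≡⟨ +-comm (T n (suc a)) _ ⟩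
      T n (2 + a) + T n (suc a) ≡⟨ T-pascal n (suc a) ⟨
      T (suc n) (2 + a)         ∎
      where
      open ≤-Reasoning
      double : a + (2 + a) ≡ suc a + suc a
      double = +-suc a (suc a)
      rearrange₁ : ∀ E a k → suc a + suc a + k + E + 0 ≡ suc E + (suc (a + a) + k)
      rearrange₁ = solve-∀
      rearrange₂ : ∀ E a → E + suc (a + a) + 2 ≡ suc (suc a + suc a) + E
      rearrange₂ = solve-∀
      -- At either end of the half period `a` and `2 + a` are mirror images modulo `k`; strictly
      -- inside, induction applies twice.
      two-steps : T n a ≤ T n (2 + a)
      two-steps with m≤n⇒m<n∨m≡n (s≤s⁻¹ h₁) | m≤n⇒m<n∨m≡n (s≤s⁻¹ h₂)
      ... | _ | inj₂ eq = ≤-reflexive (T-reflect n a (2 + a)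
              (trans (cong (_% k) (trans double eq)) (+2ck n c)))
      ... | inj₂ eq | inj₁ _ = ≤-reflexive (T-reflect n a (2 + a) (trans (cong (_% k) double)
              (trans (sym ([m+n]%n≡m%n (suc a + suc a) k)) (trans (cong (_% k) (sym eq)) (+2ck n c)))))
      ... | inj₁ lt₁ | inj₁ lt₂ = ≤-trans
              (T-mono n a c (≤-certificate 0 lt₁ (rearrange₁ (n + (c * k + c * k)) a k))
                            (≤-certificate 2 lt₂ (rearrange₂ (n + (c * k + c * k)) a)))
              (T-mono n (suc a) c (≤-trans (s≤s⁻¹ h₁) (n≤1+n _)) lt₂)

    T-climb : ∀ n m j → n ≤ suc (m + m) + k → (j + m) + (j + m) ≤ suc n → T n m ≤ T n (j + m)
    T-climb n m zero    h₁ h₂ = ≤-refl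
    T-climb n m (suc j) h₁ h₂ = ≤-trans (T-climb n m j h₁ (≤-trans (+-mono-≤ (n≤1+n (j + m)) (n≤1+n (j + m))) h₂))
      (T-mono n (j + m) 0
        (≤-trans (≤-reflexive (+-identityʳ n)) (≤-trans h₁ (+-monoˡ-≤ k (s≤s (+-mono-≤ (m≤n+m m j) (m≤n+m m j))))))
        (≤-trans (s≤s⁻¹ (≤-trans (≤-reflexive (cong suc (sym (+-suc (j + m) (j + m))))) h₂)) (m≤m+n n 0)))

    n≤ : ∀ {n m m′} → m′ ≤ m → k + m + m′ ≡ n → n ≤ suc (m + m) + k
    n≤ {m = m} {m′} m′≤m refl = ≤-certificate 1 m′≤m (rearrange k m m′)
      where
      rearrange : ∀ k m m′ → m + (k + m + m′) + 1 ≡ m′ + (suc (m + m) + k)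
      rearrange = solve-∀

    -- Up to the middle, `i` is reached by climbing from `m`. Beyond it, `i` is reflected to
    -- `n ∸ i`, which is at least `suc m′` and hence at least `m`.
    T-minimal : ∀ n m m′ i → k + m + m′ ≡ n → m′ ≤ m → m ≤ suc m′ → m ≤ i → i < k + m → T n m ≤ T n i
    T-minimal n m m′ i n≡ m′≤m m≤ m≤i i< with i + i ≤? suc n
    ... | yes p = subst (λ i → T n m ≤ T n i) (m∸n+n≡m m≤i)
                    (T-climb n m (i ∸ m) (n≤ m′≤m n≡) (subst (λ i → i + i ≤ suc n) (sym (m∸n+n≡m m≤i)) p))
    ... | no ¬p = ≤-trans
            (subst (λ j → T n m ≤ T n j) (m∸n+n≡m m≤j)
              (T-climb n m (j ∸ m) (n≤ m′≤m n≡) (subst (λ j → j + j ≤ suc n) (sym (m∸n+n≡m m≤j)) 2j≤)))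
            (≤-reflexive (T-reflect n j i (cong (_% k) j+i≡n)))
      where
      j : ℕ
      j = n ∸ i
      j+i≡n : j + i ≡ n
      j+i≡n = m∸n+n≡m (≤-trans (<⇒≤ i<) (≤-trans (m≤m+n (k + m) m′) (≤-reflexive n≡)))
      m≤j : m ≤ j
      m≤j = ≤-trans m≤ (≤-certificate 0 i< (begin
        k + m + suc m′ + 0 ≡⟨ rearrange (k + m) m′ ⟩
        suc (k + m + m′)   ≡⟨ cong suc (trans n≡ (trans (sym j+i≡n) (+-comm j i))) ⟩
        suc i + j          ∎))
        where
        open ≡-Reasoning
        rearrange : ∀ p m′ → p + suc m′ + 0 ≡ suc (p + m′)
        rearrange = solve-∀
      2j≤ : j + j ≤ suc n
      2j≤ = ≤-certificate 3 (≰⇒> ¬p) (begin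
        i + i + (j + j) + 3        ≡⟨ rearrange₁ i j ⟩
        (j + i) + (j + i) + 3      ≡⟨ cong (λ x → x + x + 3) j+i≡n ⟩
        n + n + 3                  ≡⟨ rearrange₂ n ⟩
        suc (suc n) + suc n        ∎)
        where
        open ≡-Reasoning
        rearrange₁ : ∀ i j → i + i + (j + j) + 3 ≡ (j + i) + (j + i) + 3
        rearrange₁ = solve-∀
        rearrange₂ : ∀ n → n + n + 3 ≡ suc (suc n) + suc n
        rearrange₂ = solve-∀

  -- Dual multipliers and the one-sided bounds

  module Weights (n : ℕ) where

    A B : ℕ → ℕ
    A i = ∑ (suc i) (λ j → sel j i (n C j))
    B i = ∑ i (λ j → sel j i (n C j))

    -- `B i` is `A (i − k)`, read as 0 below level `k`. The multipliers of all windows containing a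
    -- level `i ≤ m` telescope to `A i − B i`, which is therefore exactly `n C i`.
    A≡B+C : ∀ i → A i ≡ B i + n C i
    A≡B+C i = trans (∑-last i (λ j → sel j i (n C j))) (cong (B i +_) (sel-refl i (n C i)))

    B-0 : ∀ i → i < k → B i ≡ 0
    B-0 i i<k = ∑-zero i (λ j j<i → sel-between (n C j) j<i (≤-trans i<k (m≤m+n k j)))

    B-shift : ∀ m → B (k + m) ≡ A m
    B-shift m = begin
      ∑ (k + m) (λ j → sel j (k + m) (n C j))
        ≡⟨ cong (λ l → ∑ l (λ j → sel j (k + m) (n C j))) (cong suc (+-comm k₁ m)) ⟩
      ∑ (suc m + k₁) (λ j → sel j (k + m) (n C j))
        ≡⟨ ∑-split (suc m) k₁ (λ j → sel j (k + m) (n C j)) ⟩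
      ∑ (suc m) (λ j → sel j (k + m) (n C j)) + ∑ k₁ (λ i → sel (suc m + i) (k + m) (n C (suc m + i)))
        ≡⟨ cong₂ _+_ (∑-cong (suc m) (λ j _ → sel-residue j (k + m) m (n C j) (+k m)))
             (∑-zero k₁ (λ i i<k₁ → sel-between (n C (suc m + i))
               (s≤s (subst (m + i <_) (+-comm m k₁) (+-monoʳ-< m i<k₁)))
               (+-monoʳ-< k (s≤s (m≤m+n m i))))) ⟩
      A m + 0
        ≡⟨ +-identityʳ (A m) ⟩
      A m ∎
      where open ≡-Reasoning

    -- This makes the multipliers nonnegative: each term `j` of `A m` is at most the term `suc j` of
    -- `A (suc m)`.
    A-mono : ∀ m → suc (m + m) ≤ n → A m ≤ A (suc m)
    A-mono m h = ≤-trans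
      (∑-mono (suc m) λ j j≤m → ≤-trans
        (sel-mono j m (C-mono n j (≤-trans (s≤s (+-mono-≤ (s≤s⁻¹ j≤m) (s≤s⁻¹ j≤m))) h)))
        (≤-reflexive (sym (sel-shift 1 j m (n C suc j)))))
      (m≤n+m _ (sel 0 (suc m) (n C 0)))

    -- The row is cut after level `i`; reflecting its upper part gives the terms of `B j`.
    T≡A+B : ∀ i j → i + j ≡ n → T n i ≡ A i + B j
    T≡A+B i j i+j≡n = begin
      ∑ (suc n) (λ l → sel l i (n C l))       ≡⟨ cong (λ l → ∑ (suc l) (λ l → sel l i (n C l))) (sym i+j≡n) ⟩
      ∑ (suc i + j) (λ l → sel l i (n C l))   ≡⟨ ∑-split (suc i) j (λ l → sel l i (n C l)) ⟩
      A i + ∑ j (λ l → sel (suc i + l) i (n C (suc i + l)))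
        ≡⟨ cong (A i +_) (∑-reverse j {λ l → sel (suc i + l) i (n C (suc i + l))} {λ l → sel l j (n C l)} reflected) ⟩
      A i + B j                               ∎
      where
      open ≡-Reasoning
      reflected : ∀ l → l < j → sel (suc i + (j ∸ suc l)) i (n C (suc i + (j ∸ suc l))) ≡ sel l j (n C l)
      reflected l l<j = trans
        (cong (sel p i) (nCk≡nCj n p l p+l≡n))
        (sel-reflect p l i j (n C l) (cong (_% k) (trans p+l≡n (sym i+j≡n))))
        where
        p = suc i + (j ∸ suc l)
        rearrange : ∀ a b c → suc a + b + c ≡ a + (b + suc c)
        rearrange = solve-∀
        p+l≡n : p + l ≡ n
        p+l≡n = trans (rearrange i (j ∸ suc l) l) (trans (cong (i +_) (m∸n+n≡m l<j)) i+j≡n)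

    -- Weak duality on one side of the middle levels: window s is used with multiplier A s ∸ A (s − 1).
    module OneSided (y : ℕ → ℕ) where

      Y : ℕ → ℕ
      Y s = ∑ k (λ i → y (i + s))

      -- By summation by parts, `weighted m` minus `residual m` is the sum of the windows `Y s`,
      -- `s ≤ m`, with their multipliers.
      weighted : ℕ → ℕ
      weighted m = ∑ m (λ i → A i * y i) + A m * Y m

      residual : ℕ → ℕ
      residual m = ∑ (k + m) (λ i → B i * y i)

      slide : ∀ m → y m + Y (suc m) ≡ Y m + y (k + m)
      slide m = trans (cong (y m +_) (∑-cong k (λ i _ → cong y (+-suc i m)))) (∑-last k (λ i → y (i + m)))

      -- The slacks defer window inequalities: `d` collects window sums not yet compared with `n`,
      -- and `c` one `n` for each of them.
      Bound : ℕ → ℕ → ℕ → Set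
      Bound c d m = n * A m + residual m + d ≤ weighted m + c

      bound-0 : Bound n (Y 0) 0
      bound-0 = ≤-reflexive (begin
        n * A 0 + residual 0 + Y 0   ≡⟨ cong₂ (λ a r → n * a + r + Y 0) A0≡1 residual≡0 ⟩
        n * 1 + 0 + Y 0              ≡⟨ rearrange n (Y 0) ⟩
        1 * Y 0 + n                  ≡⟨ cong (λ a → a * Y 0 + n) A0≡1 ⟨
        A 0 * Y 0 + n                ∎)
        where
        open ≡-Reasoning
        A0≡1 : A 0 ≡ 1
        A0≡1 = trans (A≡B+C 0) (nC0≡1 n)
        residual≡0 : residual 0 ≡ 0
        residual≡0 = ∑-zero (k + 0) (λ i i< → cong (_* y i) (B-0 i (subst (i <_) (+-identityʳ k) i<)))
        rearrange : ∀ n Y → n * 1 + 0 + Y ≡ 1 * Y + n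
        rearrange = solve-∀

      -- The window `suc m` enters with multiplier `D`; `slide` accounts for the level that leaves
      -- and the level that enters.
      advance : ∀ {c d} c′ d′ m D → A (suc m) ≡ A m + D → D * n + d′ ≤ D * Y (suc m) + c′ →
                Bound c d m → Bound (c + c′) (d + d′) (suc m)
      advance {c} {d} c′ d′ m D A≡ gain bound = ≤-certificate 0 (+-mono-≤ bound gain) (begin
        weighted m + c + (D * V + c′) + (n * A (suc m) + residual (suc m) + (d + d′)) + 0
          ≡⟨ cong₂ (λ a r → weighted m + c + (D * V + c′) + (n * a + r + (d + d′)) + 0) A≡ residual-suc ⟩
        (P + a * Y m) + c + (D * V + c′) + (n * (a + D) + (residual m + a * z) + (d + d′)) + 0
          ≡⟨ rearrange₁ P (a * Y m) (a * z) c (D * V) c′ n a D (residual m) d d′ ⟩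
        P + (a * Y m + a * z) + X
          ≡⟨ cong (λ x → P + x + X) (trans (sym (*-distribˡ-+ a (Y m) z)) (cong (a *_) (sym (slide m)))) ⟩
        P + a * (y m + V) + X
          ≡⟨ rearrange₂ P a (y m) V c D c′ n (residual m) d d′ ⟩
        n * a + residual m + d + (D * n + d′) + ((P + a * y m) + (a + D) * V + (c + c′))
          ≡⟨ cong₂ (λ a′ p → n * a + residual m + d + (D * n + d′) + (p + a′ * V + (c + c′))) A≡ (∑-last m (λ i → A i * y i)) ⟨
        n * A m + residual m + d + (D * n + d′) + (weighted (suc m) + (c + c′)) ∎)
        where
        open ≡-Reasoning
        P = ∑ m (λ i → A i * y i)
        a = A m
        V = Y (suc m)
        z = y (k + m)
        X = c + D * V + c′ + n * a + n * D + residual m + d + d′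
        residual-suc : residual (suc m) ≡ residual m + a * z
        residual-suc = trans (cong (λ l → ∑ l (λ i → B i * y i)) (+-suc k m))
          (trans (∑-last (k + m) (λ i → B i * y i)) (cong (λ b → residual m + b * z) (B-shift m)))
        rearrange₁ : ∀ P U Z c DV c′ n a D r d d′ →
          (P + U) + c + (DV + c′) + (n * (a + D) + (r + Z) + (d + d′)) + 0 ≡
          P + (U + Z) + (c + DV + c′ + n * a + n * D + r + d + d′)
        rearrange₁ = solve-∀
        rearrange₂ : ∀ P a q V c D c′ n r d d′ →
          P + a * (q + V) + (c + D * V + c′ + n * a + n * D + r + d + d′) ≡
          n * a + r + d + (D * n + d′) + ((P + a * q) + (a + D) * V + (c + c′))
        rearrange₂ = solve-∀

      bound-suc : ∀ {c d} m → suc (m + m) ≤ n → n ≤ Y (suc m) → Bound c d m → Bound c d (suc m)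
      bound-suc {c} {d} m h n≤Y bound = subst₂ (λ c d → Bound c d (suc m)) (+-identityʳ c) (+-identityʳ d)
        (advance 0 0 m (A (suc m) ∸ A m) (sym (m+[n∸m]≡n (A-mono m h)))
          (+-monoˡ-≤ 0 (*-monoʳ-≤ (A (suc m) ∸ A m) n≤Y)) bound)

      -- Window 1 has multiplier `n − 1`; only `n − 2` copies are spent, and one is deferred for the
      -- case where it exceeds `n`.
      bound-1 : 1 ≤ k₁ → 2 ≤ n → n ≤ Y 1 → Bound (n + n) (Y 0 + Y 1) 1
      bound-1 1≤k₁ 2≤n n≤Y = advance n (Y 1) 0 (suc D) A1≡ gain bound-0
        where
        D = n ∸ 2
        A1≡ : A 1 ≡ A 0 + suc D
        A1≡ = trans (trans (A≡B+C 1) (cong₂ _+_ (B-0 1 (s≤s 1≤k₁)) (nC1≡n n)))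
          (trans (sym (m+[n∸m]≡n 2≤n)) (cong (_+ suc D) (sym (trans (A≡B+C 0) (nC0≡1 n)))))
        gain : suc D * n + Y 1 ≤ suc D * Y 1 + n
        gain = ≤-certificate 0 (*-monoʳ-≤ D n≤Y) (rearrange (D * Y 1) (D * n) n (Y 1))
          where
          rearrange : ∀ p q n Y → p + ((n + q) + Y) + 0 ≡ q + ((Y + p) + n)
          rearrange = solve-∀

      bound-climb : ∀ {c d} m j → (j + m) + (j + m) ≤ suc n → (∀ s → m < s → s ≤ j + m → n ≤ Y s) →
                    Bound c d m → Bound c d (j + m)
      bound-climb m zero    h windows bound = bound
      bound-climb m (suc j) h windows bound = bound-suc (j + m)
        (s≤s⁻¹ (≤-trans (≤-reflexive (cong suc (sym (+-suc (j + m) (j + m))))) h))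
        (windows (suc j + m) (s≤s (m≤n+m m j)) ≤-refl)
        (bound-climb m j (≤-trans (+-mono-≤ (n≤1+n (j + m)) (n≤1+n (j + m))) h)
          (λ s m<s s≤ → windows s m<s (≤-trans s≤ (n≤1+n (j + m)))) bound)

      -- Up to level `m` the coefficients become binomial. The `k₁` levels above it are kept apart,
      -- since the windows from the other side reach them too.
      bound-split : ∀ {c d} m → Bound c d m →
        n * A m + ∑ k₁ (λ i → B (suc m + i) * y (suc m + i)) + d ≤
        ∑ (suc m) (λ i → (n C i) * y i) + A m * ∑ k₁ (λ i → y (suc m + i)) + c
      bound-split {c} {d} m bound = ≤-certificate 0 bound (begin
        weighted m + c + (n * A m + ν + d) + 0
          ≡⟨ cong (λ w → w + c + (n * A m + ν + d) + 0) weighted-split ⟩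
        p + β + A m * M + c + (n * A m + ν + d) + 0
          ≡⟨ rearrange p β (A m * M) c (n * A m) ν d ⟩
        n * A m + (β + ν) + d + (p + A m * M + c)
          ≡⟨ cong (λ r → n * A m + r + d + (p + A m * M + c)) residual-split ⟨
        n * A m + residual m + d + (p + A m * M + c) ∎)
        where
        open ≡-Reasoning
        p = ∑ (suc m) (λ i → (n C i) * y i)
        β = ∑ (suc m) (λ i → B i * y i)
        ν = ∑ k₁ (λ i → B (suc m + i) * y (suc m + i))
        M = ∑ k₁ (λ i → y (suc m + i))
        rearrange : ∀ p β a c nA ν d → p + β + a + c + (nA + ν + d) + 0 ≡ nA + (β + ν) + d + (p + a + c)
        rearrange = solve-∀
        residual-split : residual m ≡ β + ν
        residual-split = trans (cong (λ l → ∑ l (λ i → B i * y i)) (cong suc (+-comm k₁ m)))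
          (∑-split (suc m) k₁ (λ i → B i * y i))
        weighted-split : weighted m ≡ p + β + A m * M
        weighted-split = begin
          ∑ m (λ i → A i * y i) + A m * Y m
            ≡⟨ cong (λ x → ∑ m (λ i → A i * y i) + A m * (y m + x))
                 (∑-cong k₁ (λ i _ → cong (λ l → y (suc l)) (+-comm i m))) ⟩
          ∑ m (λ i → A i * y i) + A m * (y m + M)
            ≡⟨ cong (∑ m (λ i → A i * y i) +_) (*-distribˡ-+ (A m) (y m) M) ⟩
          ∑ m (λ i → A i * y i) + (A m * y m + A m * M)
            ≡⟨ +-assoc (∑ m (λ i → A i * y i)) (A m * y m) (A m * M) ⟨
          ∑ m (λ i → A i * y i) + A m * y m + A m * M
            ≡⟨ cong (_+ A m * M) (∑-last m (λ i → A i * y i)) ⟨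
          ∑ (suc m) (λ i → A i * y i) + A m * M
            ≡⟨ cong (_+ A m * M) (∑-cong (suc m) (λ i _ → trans (cong (_* y i) (trans (A≡B+C i) (+-comm (B i) (n C i))))
                 (*-distribʳ-+ (y i) (n C i) (B i)))) ⟩
          ∑ (suc m) (λ i → (n C i) * y i + B i * y i) + A m * M
            ≡⟨ cong (_+ A m * M) (∑-+ (suc m) (λ i → (n C i) * y i) (λ i → B i * y i)) ⟩
          p + β + A m * M ∎

  -- Joining the two sides over the middle levels

  module Duality (1≤k₁ : 1 ≤ k₁) (n m m′ : ℕ) (k+m+m′≡n : k + m + m′ ≡ n) (m′≤m : m′ ≤ m) (m≤1+m′ : m ≤ suc m′)
                 (y : ℕ → ℕ) where

    open Weights n
    module L = OneSided y
    module R = OneSided (λ i → y (n ∸ i))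

    from-sum : ∀ a {b} → a + b ≡ n → n ∸ a ≡ b
    from-sum a {b} eq = trans (cong (_∸ a) (sym eq)) (m+n∸m≡n a b)

    reversed-window : ∀ s s′ → s + s′ + k ≡ suc n → R.Y s ≡ L.Y s′
    reversed-window s s′ eq = ∑-reverse k {λ i → y (n ∸ (i + s))} {λ i → y (i + s′)} λ i i<k →
      cong y (from-sum (k ∸ suc i + s) (suc-injective (begin
        suc (k ∸ suc i + s + (i + s′))   ≡⟨ rearrange (k ∸ suc i) s i s′ ⟩
        s + s′ + (k ∸ suc i + suc i)     ≡⟨ cong (s + s′ +_) (m∸n+n≡m i<k) ⟩
        s + s′ + k                       ≡⟨ eq ⟩
        suc n                            ∎)))
      where
      open ≡-Reasoning
      rearrange : ∀ a s i s′ → suc (a + s + (i + s′)) ≡ s + s′ + (a + suc i)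
      rearrange = solve-∀

    -- The multipliers of the two sides add up to `A m` and `A m′`, so the total constant is
    -- `n * T n m`.
    T≡A+A : T n m ≡ A m + A m′
    T≡A+A = trans (T≡A+B m (k + m′) (trans (rearrange m k m′) k+m+m′≡n)) (cong (A m +_) (B-shift m′))
      where
      rearrange : ∀ m k m′ → m + (k + m′) ≡ k + m + m′
      rearrange = solve-∀

    combine : ∀ {c d c′ d′} → L.Bound c d m → R.Bound c′ d′ m′ →
              n * T n m + d + d′ ≤ ∑ (suc n) (λ i → (n C i) * y i) + c + c′
    combine {c} {d} {c′} {d′} left right = begin
      n * T n m + d + d′             ≡⟨ cong (λ t → n * t + d + d′) T≡A+A ⟩
      n * (A m + A m′) + d + d′
        ≤⟨ ≤-certificate 0 (+-mono-≤ (+-mono-≤ (L.bound-split m left) right′) middle)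
             (rearrange p (A m) M c p′ (A m′) c′ μ ν ν′ n d d′) ⟩
      p + (μ + p′) + c + c′          ≡⟨ cong (λ w → w + c + c′) total ⟨
      ∑ (suc n) (λ i → (n C i) * y i) + c + c′ ∎
      where
      open ≤-Reasoning
      p = ∑ (suc m) (λ i → (n C i) * y i)
      p′ = ∑ (suc m′) (λ i → (n C i) * y (n ∸ i))
      M = ∑ k₁ (λ i → y (suc m + i))
      μ = ∑ k₁ (λ i → (n C (suc m + i)) * y (suc m + i))
      ν = ∑ k₁ (λ i → B (suc m + i) * y (suc m + i))
      ν′ = ∑ k₁ (λ i → B (n ∸ (suc m + i)) * y (suc m + i))
      rearrange : ∀ p a M c p′ a′ c′ μ ν ν′ n d d′ →
        p + a * M + c + (p′ + a′ * M + c′) + (μ + ν + ν′) + (n * (a + a′) + d + d′) + 0 ≡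
        n * a + ν + d + (n * a′ + ν′ + d′) + (a + a′) * M + (p + (μ + p′) + c + c′)
      rearrange = solve-∀

      mirrored : ∀ i → i < k₁ → suc m′ + (k₁ ∸ suc i) + (suc m + i) ≡ n
      mirrored i i<k₁ = trans (shuffle m′ (k₁ ∸ suc i) m i)
        (trans (cong (λ l → suc l + m + m′) (m∸n+n≡m i<k₁)) k+m+m′≡n)
        where
        shuffle : ∀ m′ a m i → suc m′ + a + (suc m + i) ≡ suc (a + suc i) + m + m′
        shuffle = solve-∀

      right′ : n * A m′ + ν′ + d′ ≤ p′ + A m′ * M + c′
      right′ = subst₂ (λ v w → n * A m′ + v + d′ ≤ p′ + A m′ * w + c′)
        (∑-reverse k₁ {λ i → B (suc m′ + i) * y (n ∸ (suc m′ + i))} {λ i → B (n ∸ (suc m + i)) * y (suc m + i)}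
          λ i i<k₁ → cong₂ (λ a b → B a * y b)
            (sym (from-sum (suc m + i) (trans (+-comm (suc m + i) (suc m′ + (k₁ ∸ suc i))) (mirrored i i<k₁))))
            (from-sum (suc m′ + (k₁ ∸ suc i)) (mirrored i i<k₁)))
        (∑-reverse k₁ {λ i → y (n ∸ (suc m′ + i))} {λ i → y (suc m + i)}
          λ i i<k₁ → cong y (from-sum (suc m′ + (k₁ ∸ suc i)) (mirrored i i<k₁)))
        (R.bound-split m′ right)

      -- At a middle level `l` the claim is `T n m ≤ B l + n C l + B (n ∸ l)`. The right side is
      -- `T n l`, so it is the minimality of `T` at `m`.
      middle : (A m + A m′) * M ≤ μ + ν + ν′
      middle = begin
        (A m + A m′) * M  ≡⟨ ∑-*ˡ k₁ (A m + A m′) (λ i → y (suc m + i)) ⟨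
        ∑ k₁ (λ i → (A m + A m′) * y (suc m + i)) ≤⟨ ∑-mono k₁ termwise ⟩
        ∑ k₁ (λ i → (n C (suc m + i)) * y (suc m + i) + B (suc m + i) * y (suc m + i) + B (n ∸ (suc m + i)) * y (suc m + i))
          ≡⟨ ∑-+ k₁ (λ i → (n C (suc m + i)) * y (suc m + i) + B (suc m + i) * y (suc m + i)) (λ i → B (n ∸ (suc m + i)) * y (suc m + i)) ⟩
        ∑ k₁ (λ i → (n C (suc m + i)) * y (suc m + i) + B (suc m + i) * y (suc m + i)) + ν′
          ≡⟨ cong (_+ ν′) (∑-+ k₁ (λ i → (n C (suc m + i)) * y (suc m + i)) (λ i → B (suc m + i) * y (suc m + i))) ⟩
        μ + ν + ν′ ∎
        where
        distribute : ∀ w b b′ v → (b + w + b′) * v ≡ w * v + b * v + b′ * v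
        distribute = solve-∀
        termwise : ∀ i → i < k₁ → (A m + A m′) * y (suc m + i) ≤
          (n C (suc m + i)) * y (suc m + i) + B (suc m + i) * y (suc m + i) + B (n ∸ (suc m + i)) * y (suc m + i)
        termwise i i<k₁ = begin
          (A m + A m′) * y l                    ≡⟨ cong (_* y l) T≡A+A ⟨
          T n m * y l                           ≤⟨ *-monoˡ-≤ (y l) (Unimodal.T-minimal 1≤k₁ n m m′ l k+m+m′≡n m′≤m m≤1+m′
                                                     (≤-trans (n≤1+n m) (m≤m+n (suc m) i))
                                                     (s≤s (subst (m + i <_) (+-comm m k₁) (+-monoʳ-< m i<k₁)))) ⟩
          T n l * y l                           ≡⟨ cong (_* y l) (T≡A+B l (n ∸ l) (m+[n∸m]≡n l≤n)) ⟩
          (A l + B (n ∸ l)) * y l               ≡⟨ cong (λ a → (a + B (n ∸ l)) * y l) (A≡B+C l) ⟩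
          (B l + n C l + B (n ∸ l)) * y l       ≡⟨ distribute (n C l) (B l) (B (n ∸ l)) (y l) ⟩
          (n C l) * y l + B l * y l + B (n ∸ l) * y l ∎
          where
          l = suc m + i
          l≤n : l ≤ n
          l≤n = ≤-trans (m≤n+m l (suc m′ + (k₁ ∸ suc i))) (≤-reflexive (mirrored i i<k₁))

      total : ∑ (suc n) (λ i → (n C i) * y i) ≡ p + (μ + p′)
      total = trans (cong (λ l → ∑ l (λ i → (n C i) * y i)) (trans (cong suc (sym k+m+m′≡n)) (shuffle k₁ m m′)))
        (trans (∑-split (suc m) (k₁ + suc m′) (λ i → (n C i) * y i)) (cong (p +_)
          (trans (∑-split k₁ (suc m′) (λ i → (n C (suc m + i)) * y (suc m + i))) (cong (μ +_)
            (∑-reverse (suc m′) {λ i → (n C (suc m + (k₁ + i))) * y (suc m + (k₁ + i))} {λ i → (n C i) * y (n ∸ i)} reflected)))))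
        where
        shuffle : ∀ k₁ m m′ → suc (suc k₁ + m + m′) ≡ suc m + (k₁ + suc m′)
        shuffle = solve-∀
        shuffle′ : ∀ k₁ m a i → suc m + (k₁ + a) + i ≡ suc k₁ + m + (a + i)
        shuffle′ = solve-∀
        reflected : ∀ i → i < suc m′ →
          (n C (suc m + (k₁ + (m′ ∸ i)))) * y (suc m + (k₁ + (m′ ∸ i))) ≡ (n C i) * y (n ∸ i)
        reflected i i≤m′ = cong₂ (λ a b → a * y b) (nCk≡nCj n q i q+i≡n)
          (sym (from-sum i (trans (+-comm i q) q+i≡n)))
          where
          q = suc m + (k₁ + (m′ ∸ i))
          q+i≡n : q + i ≡ n
          q+i≡n = trans (shuffle′ k₁ m (m′ ∸ i) i) (trans (cong (k + m +_) (m∸n+n≡m (s≤s⁻¹ i≤m′))) k+m+m′≡n)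

half : ∀ p → let m = (p + 1) / 2 ; m′ = p ∸ m in m + m′ ≡ p × m′ ≤ m × m ≤ suc m′
half p = m+m′≡p , m′≤m , m≤1+m′
  where
  open ≤-Reasoning
  m = (p + 1) / 2
  m′ = p ∸ m
  double : ∀ m → m * 2 ≡ m + m
  double = solve-∀
  2m≤ : m + m ≤ p + 1
  2m≤ = subst (_≤ p + 1) (double m) (m/n*n≤m (p + 1) 2)
  ≤2m : p ≤ m + m
  ≤2m = +-cancelʳ-≤ 1 p (m + m) (begin
    p + 1                      ≡⟨ m≡m%n+[m/n]*n (p + 1) 2 ⟩
    (p + 1) % 2 + m * 2        ≤⟨ +-monoˡ-≤ (m * 2) (s≤s⁻¹ (m%n<n (p + 1) 2)) ⟩
    1 + m * 2                  ≡⟨ trans (+-comm 1 (m * 2)) (cong (_+ 1) (double m)) ⟩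
    m + m + 1                  ∎)
  m≤p : m ≤ p
  m≤p = ≮⇒≥ λ p<m → 1+n≰n (begin
    suc (p + 1)    ≡⟨ cong suc (+-comm p 1) ⟩
    2 + p          ≤⟨ s≤s (m≤n+m (suc p) p) ⟩
    suc p + suc p  ≤⟨ +-mono-≤ p<m p<m ⟩
    m + m          ≤⟨ 2m≤ ⟩
    p + 1          ∎)
  m+m′≡p : m + m′ ≡ p
  m+m′≡p = m+[n∸m]≡n m≤p
  m′≤m : m′ ≤ m
  m′≤m = +-cancelˡ-≤ m m′ m (≤-trans (≤-reflexive m+m′≡p) ≤2m)
  m≤1+m′ : m ≤ suc m′
  m≤1+m′ = +-cancelˡ-≤ m m (suc m′) (≤-trans 2m≤
    (≤-reflexive (trans (cong (_+ 1) (sym m+m′≡p)) (trans (+-comm (m + m′) 1) (sym (+-suc m m′))))))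

-- The bound for a fixed cyclic permutation

module Main (n₁ k′ : ℕ) (k≤n : 3 + k′ ≤ suc n₁) (𝓕 : Family (suc n₁))
            (¬Y : ¬ CopyY (3 + k′) 𝓕) (¬Y′ : ¬ CopyY′ (3 + k′) 𝓕) (σ : Permutation′ (suc n₁)) where

  n k m m′ : ℕ
  n = suc n₁
  k = 3 + k′
  m = (n ∸ k + 1) / 2
  m′ = n ∸ k ∸ m

  open Cycle σ

  f : ℕ → ℕ → Bool
  f t s = 𝓕 (arc t s)

  module G = Grid n k′ z<s f (λ t s → cong 𝓕 (arc-periodic t s)) (no-arc-Y 𝓕 k′ ¬Y) (no-arc-Y′ 𝓕 k′ ¬Y′)
  open G using (y; Y)

  k+m+m′≡n : k + m + m′ ≡ n
  k+m+m′≡n = trans (+-assoc k m m′) (trans (cong (k +_) (proj₁ (half (n ∸ k)))) (m+[n∸m]≡n k≤n))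

  m′≤m : m′ ≤ m
  m′≤m = proj₁ (proj₂ (half (n ∸ k)))

  m≤1+m′ : m ≤ suc m′
  m≤1+m′ = proj₂ (proj₂ (half (n ∸ k)))

  open Residues (2 + k′) using (T; sel; sel-≤; module Duality; module Weights)
  module D = Duality (s≤s z≤n) n m m′ k+m+m′≡n m′≤m m≤1+m′ y
  open Weights n using (A)

  W : ℕ
  W = ∑ (suc n) (λ i → (n C i) * y i)

  top : ℕ
  top = n ∸ (2 + k′)

  top+ : top + (2 + k′) ≡ n
  top+ = m∸n+n≡m (≤-trans (n≤1+n (2 + k′)) k≤n)

  2m≤1+n : m + m ≤ suc n
  2m≤1+n = ≤-certificate k m≤1+m′ (trans (rearrange k m m′) (cong (λ x → m + suc x) k+m+m′≡n))
    where
    rearrange : ∀ k m m′ → suc m′ + (m + m) + k ≡ m + suc (k + m + m′)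
    rearrange = solve-∀

  left-window : ∀ s → 1 ≤ s → s ≤ m → n ≤ Y s
  left-window s 1≤s s≤m = G.interior-window s 1≤s (≤-trans (+-monoˡ-≤ k s≤m)
    (≤-trans (m≤m+n (m + k) m′) (≤-reflexive (trans (cong (_+ m′) (+-comm m k)) k+m+m′≡n))))

  right-window : ∀ s → 0 < s → s ≤ m′ → n ≤ D.R.Y s
  right-window (suc s) _ s<m′ = subst (n ≤_) (sym (D.reversed-window (suc s) s′ eq))
    (G.interior-window s′ 1≤s′ (m+n≤o⇒n≤o s (≤-reflexive (trans (sym (+-assoc s s′ k)) (suc-injective eq)))))
    where
    -- The reversed window `suc s` starts at the ordinary level `n + 1 − k − suc s`, rewritten
    -- through `k + m + m′ ≡ n`.
    s′ = m + suc (m′ ∸ suc s)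
    1≤s′ : 1 ≤ s′
    1≤s′ = ≤-trans (s≤s z≤n) (m≤n+m (suc (m′ ∸ suc s)) m)
    eq : suc s + s′ + k ≡ suc n
    eq = trans (rearrange s m (m′ ∸ suc s) k)
      (cong suc (trans (cong (k + m +_) (m∸n+n≡m s<m′)) k+m+m′≡n))
      where
      rearrange : ∀ s m a k → suc s + (m + suc a) + k ≡ suc (k + m + (a + suc s))
      rearrange = solve-∀

  left : D.L.Bound n (Y 0) m
  left = subst (D.L.Bound n (Y 0)) (+-identityʳ m)
    (D.L.bound-climb 0 m (subst (λ i → i + i ≤ suc n) (sym (+-identityʳ m)) 2m≤1+n)
      (λ s 1≤s s≤ → left-window s 1≤s (subst (s ≤_) (+-identityʳ m) s≤)) D.L.bound-0)

  left-1 : 1 ≤ m → D.L.Bound (n + n) (Y 0 + Y 1) m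
  left-1 1≤m = subst (D.L.Bound (n + n) (Y 0 + Y 1)) (m∸n+n≡m 1≤m)
    (D.L.bound-climb 1 (m ∸ 1) (subst (λ i → i + i ≤ suc n) (sym (m∸n+n≡m 1≤m)) 2m≤1+n)
      (λ s 1<s s≤ → left-window s (<⇒≤ 1<s) (subst (s ≤_) (m∸n+n≡m 1≤m) s≤))
      (D.L.bound-1 (s≤s z≤n) (≤-trans (s≤s (s≤s z≤n)) k≤n) (left-window 1 ≤-refl 1≤m)))

  right : D.R.Bound n (Y top) m′
  right = subst₂ (D.R.Bound n) (D.reversed-window 0 top top-eq) (+-identityʳ m′)
    (D.R.bound-climb 0 m′ (subst (λ i → i + i ≤ suc n) (sym (+-identityʳ m′)) (≤-trans (+-mono-≤ m′≤m m′≤m) 2m≤1+n))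
      (λ s 1≤s s≤ → right-window s 1≤s (subst (s ≤_) (+-identityʳ m′) s≤)) D.R.bound-0)
    where
    top-eq : 0 + top + k ≡ suc n
    top-eq = trans (+-suc top (2 + k′)) (cong suc top+)

  arcs-at-n : ∀ t → f t n ≡ 𝓕 ⊤
  arcs-at-n t = cong 𝓕 (arc-n t)

  Goal : Set
  Goal = n * T n m + 1 ≤ W + n

  -- Only the two end windows are deferred in `left` and `right`, so it suffices that together they
  -- exceed `n`.
  enough : suc n ≤ Y 0 + Y top → Goal
  enough h = ≤-certificate 0 (+-mono-≤ (D.combine left right) h) (rearrange (n * T n m) n (Y 0) (Y top) W)
    where
    rearrange : ∀ t n a b w → w + n + n + (a + b) + (t + 1) + 0 ≡ t + a + b + suc n + (w + n)
    rearrange = solve-∀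

  positive : ∀ a → n ≤ a + a → 1 ≤ a
  positive (suc a) _ = z<s

  -- Each end window is at least `n / 2`. If their sum does not exceed `n`, the bottom window is
  -- tight; for `k < n` the copy of window 1 deferred in `left-1` then supplies the missing unit.
  both-ends : 𝓕 ⊥ ≡ true → 𝓕 ⊤ ≡ true → Goal
  both-ends ⊥∈ ⊤∈ with suc n ≤? Y 0 + Y top
  ... | yes h = enough h
  ... | no ¬h with m≤n⇒m<n∨m≡n k≤n
  ...   | inj₁ k<n = ≤-certificate 0 (+-mono-≤ (D.combine (left-1 1≤m) right) (+-mono-≤ n≤ends second))
                       (rearrange (n * T n m) n (Y 0) (Y top) (Y 1) W)
    where
    module Bottom = G.Bottom (λ _ → ⊥∈) k≤n
    module Top = G.Top (λ t → trans (arcs-at-n t) ⊤∈) k≤n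
    n≤ends : n ≤ Y 0 + Y top
    n≤ends = ≮⇒≥ λ lt → <⇒≱ (+-mono-< lt lt)
      (≤-certificate 0 (+-mono-≤ Bottom.bottom-window Top.top-window) (rearrange′ (Y 0) (Y top) n))
      where
      rearrange′ : ∀ a b n → a + a + (b + b) + (n + n) + 0 ≡ n + n + (a + b + (a + b))
      rearrange′ = solve-∀
    tight : Y 0 + Y 0 ≤ n
    tight = ≤-certificate 0 (+-mono-≤ (+-mono-≤ Y0+Yt≤n Y0+Yt≤n) Top.top-window) (rearrange′ (Y 0) (Y top) n)
      where
      Y0+Yt≤n : Y 0 + Y top ≤ n
      Y0+Yt≤n = s≤s⁻¹ (≰⇒> ¬h)
      rearrange′ : ∀ a b n → n + n + (b + b) + (a + a) + 0 ≡ a + b + (a + b) + n + n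
      rearrange′ = solve-∀
    second : suc n ≤ Y 1
    second = Bottom.Tight.second-window tight k<n
    1≤m : 1 ≤ m
    1≤m = ≮⇒≥ λ m<1 → <⇒≢ k<n (trans (sym (trans (cong (k + m +_) (n≤0⇒n≡0 (≤-trans m′≤m (s≤s⁻¹ m<1))))
            (trans (+-identityʳ (k + m)) (trans (cong (k +_) (n≤0⇒n≡0 (s≤s⁻¹ m<1))) (+-identityʳ k))))) k+m+m′≡n)
    rearrange : ∀ t n a b c w → w + (n + n) + n + (a + b + c) + (t + 1) + 0 ≡ t + (a + c) + b + (n + suc n) + (w + n)
    rearrange = solve-∀
  -- Now `m` and `m′` are 0 and `T n m` is 2. The inner binomials are at least `n`, and `Y 0` is at
  -- least 2 because twice it is at least `n ≥ 3`.
  ...   | inj₂ k≡n = begin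
    n * T n m + 1   ≡⟨ cong (λ t → n * t + 1) T≡2 ⟩
    n * 2 + 1       ≤⟨ +-mono-≤ (*-monoʳ-≤ n 2≤Y0) (s≤s z≤n) ⟩
    n * Y 0 + n     ≤⟨ +-monoˡ-≤ n nY0≤W ⟩
    W + n           ∎
    where
    open ≤-Reasoning
    module Bottom = G.Bottom (λ _ → ⊥∈) k≤n
    m≡0 : m ≡ 0
    m≡0 = cong (λ x → (x + 1) / 2) (trans (cong (n ∸_) k≡n) (n∸n≡0 n))
    A0≡1 : A 0 ≡ 1
    A0≡1 = trans (Weights.A≡B+C n 0) (nC0≡1 n)
    T≡2 : T n m ≡ 2
    T≡2 = trans D.T≡A+A (cong₂ _+_ (trans (cong A m≡0) A0≡1) (trans (cong A (n≤0⇒n≡0 (≤-trans m′≤m (≤-reflexive m≡0)))) A0≡1))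
    2≤Y0 : 2 ≤ Y 0
    2≤Y0 = ≰⇒> λ Y0≤1 → <⇒≱ (≤-trans (s≤s (s≤s (s≤s z≤n))) k≤n) (≤-trans Bottom.bottom-window (+-mono-≤ Y0≤1 Y0≤1))
    y0≡0 : y 0 ≡ 0
    y0≡0 = ∑-zero n (λ t _ → cong (λ p → if p then 0 else 1) ⊥∈)
    nY0≤W : n * Y 0 ≤ W
    nY0≤W = begin
      n * (y 0 + ∑ (2 + k′) (λ i → y (suc i + 0)))  ≡⟨ cong (λ x → n * (x + ∑ (2 + k′) (λ i → y (suc i + 0)))) y0≡0 ⟩
      n * ∑ (2 + k′) (λ i → y (suc i + 0))          ≡⟨ ∑-*ˡ (2 + k′) n (λ i → y (suc i + 0)) ⟨
      ∑ (2 + k′) (λ i → n * y (suc i + 0))          ≤⟨ ∑-mono (2 + k′) (λ i i< → *-mono-≤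
                                                         (C-interior n i (subst (suc i <_) k≡n (s≤s i<)))
                                                         (≤-reflexive (cong y (+-identityʳ (suc i))))) ⟩
      ∑ (2 + k′) (λ i → (n C suc i) * y (suc i))    ≤⟨ m≤m+n _ ((n C k) * y k) ⟩
      ∑ (2 + k′) (λ i → (n C suc i) * y (suc i)) + (n C k) * y k
        ≡⟨ ∑-last (2 + k′) (λ i → (n C suc i) * y (suc i)) ⟨
      ∑ k (λ i → (n C suc i) * y (suc i))           ≡⟨ cong (λ l → ∑ l (λ i → (n C suc i) * y (suc i))) k≡n ⟩
      ∑ n (λ i → (n C suc i) * y (suc i))           ≤⟨ m≤n+m _ ((n C 0) * y 0) ⟩
      W                                             ∎

  absent-top : 𝓕 ⊤ ≡ false → n ≤ Y top
  absent-top eq = begin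
    n                  ≡⟨ G.absent-level n (λ t → trans (arcs-at-n t) eq) ⟨
    y n                ≡⟨ cong y (trans (+-comm (2 + k′) top) top+) ⟨
    y (2 + k′ + top)   ≤⟨ ∑-term k (λ i → y (i + top)) (2 + k′) ≤-refl ⟩
    Y top              ∎
    where open ≤-Reasoning

  lower-bound : Goal
  lower-bound = by-ends (𝓕 ⊥) (𝓕 ⊤) refl refl
    where
    top-half : ∀ q → 𝓕 ⊤ ≡ q → n ≤ Y top + Y top
    top-half true  ⊤∈ = G.Top.top-window (λ t → trans (arcs-at-n t) ⊤∈) k≤n
    top-half false ⊤∉ = ≤-trans (absent-top ⊤∉) (m≤m+n (Y top) (Y top))
    -- An end outside the family makes its whole level missing, so its window reaches `n`; the
    -- window at the other end is at least one.
    by-ends : ∀ p q → 𝓕 ⊥ ≡ p → 𝓕 ⊤ ≡ q → Goal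
    by-ends true  true  ⊥∈ ⊤∈ = both-ends ⊥∈ ⊤∈
    by-ends true  false ⊥∈ ⊤∉ = enough (+-mono-≤ (positive (Y 0) (G.Bottom.bottom-window (λ _ → ⊥∈) k≤n)) (absent-top ⊤∉))
    by-ends false q     ⊥∉ ⊤q = enough (begin
      1 + n          ≤⟨ +-mono-≤ (positive (Y top) (top-half q ⊤q)) (≤-reflexive (sym (G.absent-level 0 (λ _ → ⊥∉)))) ⟩
      Y top + y 0    ≤⟨ +-monoʳ-≤ (Y top) (∑-term k (λ i → y (i + 0)) 0 z<s) ⟩
      Y top + Y 0    ≡⟨ +-comm (Y top) (Y 0) ⟩
      Y 0 + Y top    ∎)
      where open ≤-Reasoning

  -- From missing sets back to the statement

  present : ℕ → ℕ
  present i = ∑ n (λ t → if f t i then 1 else 0)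

  present+missing : ∀ i → present i + y i ≡ n
  present+missing i = trans (sym (∑-+ n (λ t → if f t i then 1 else 0) (λ t → G.missing t i)))
    (trans (∑-cong n (λ t _ → one (f t i))) (∑-one n))
    where
    one : ∀ p → (if p then 1 else 0) + (if p then 0 else 1) ≡ 1
    one true  = refl
    one false = refl

  X : ℕ
  X = ∑ (suc n) (λ i → (n C i) * present i)

  X+W : X + W ≡ n * 2 ^ n
  X+W = begin
    X + W ≡⟨ ∑-+ (suc n) (λ i → (n C i) * present i) (λ i → (n C i) * y i) ⟨
    ∑ (suc n) (λ i → (n C i) * present i + (n C i) * y i)
      ≡⟨ ∑-cong (suc n) (λ i _ → trans (sym (*-distribˡ-+ (n C i) (present i) (y i)))
           (trans (cong ((n C i) *_) (present+missing i)) (*-comm (n C i) n))) ⟩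
    ∑ (suc n) (λ i → n * (n C i)) ≡⟨ ∑-*ˡ (suc n) n (n C_) ⟩
    n * ∑ (suc n) (n C_) ≡⟨ cong (n *_) (∑-C n) ⟩
    n * 2 ^ n ∎
    where open ≡-Reasoning

  x≡present : ∀ i → x 𝓕 σ i ≡ present i
  x≡present i = trans
    (cong sum (map-cong (λ t → cong (λ p → if 𝓕 p then 1 else 0) (arc-interval t i)) (allFin n)))
    (∑-allFin n (λ t → if f t i then 1 else 0))

  present-0 : present 0 ≡ n * (if 𝓕 ⊥ then 1 else 0)
  present-0 = ∑-const n (if 𝓕 ⊥ then 1 else 0)

  present-n : present n ≡ n * (if 𝓕 ⊤ then 1 else 0)
  present-n = trans (∑-cong n (λ t _ → cong (λ p → if p then 1 else 0) (arcs-at-n t))) (∑-const n (if 𝓕 ⊤ then 1 else 0))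

  -- At levels `0` and `n` all `n` starting points give the same set, which accounts for the factor
  -- `n` at the endpoints.
  LHS≡X : endpoints 𝓕 * n + intervalSum 𝓕 σ ≡ X
  LHS≡X = begin
    (e₀ + e₁) * n + intervalSum 𝓕 σ ≡⟨ cong ((e₀ + e₁) * n +_) inner ⟩
    (e₀ + e₁) * n + I                       ≡⟨ rearrange e₀ e₁ n I ⟩
    1 * (n * e₀) + (I + 1 * (n * e₁))
      ≡⟨ cong₂ (λ a b → a + (I + b)) (cong₂ _*_ (nC0≡1 n) present-0) (cong₂ _*_ (nCn≡1 n) present-n) ⟨
    (n C 0) * present 0 + (I + (n C n) * present n) ≡⟨ cong ((n C 0) * present 0 +_) (∑-last n₁ (λ i → (n C suc i) * present (suc i))) ⟨
    X ∎
    where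
    open ≡-Reasoning
    e₀ = if 𝓕 ⊥ then 1 else 0
    e₁ = if 𝓕 ⊤ then 1 else 0
    I = ∑ n₁ (λ i → (n C suc i) * present (suc i))
    inner : intervalSum 𝓕 σ ≡ I
    inner = trans (∑-upTo n₁ (λ i → (n C suc i) * x 𝓕 σ (suc i)))
      (∑-cong n₁ (λ i _ → cong ((n C suc i) *_) (x≡present (suc i))))
    rearrange : ∀ a b n I → (a + b) * n + I ≡ 1 * (n * a) + (I + 1 * (n * b))
    rearrange = solve-∀

  S≡T : S n k m ≡ T n m
  S≡T = ∑-upTo (suc n) (λ i → sel i m (n C i))

  -- This makes the truncated subtraction in the final bound a genuine one.
  T≤2^n : T n m ≤ 2 ^ n
  T≤2^n = ≤-trans (∑-mono (suc n) (λ i _ → sel-≤ i m (n C i))) (≤-reflexive (∑-C n))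

  conclusion : endpoints 𝓕 * n + intervalSum 𝓕 σ ≤ n * (2 ^ n ∸ S n k m) + n ∸ 1
  conclusion = subst₂ (λ a s → a ≤ n * (2 ^ n ∸ s) + n ∸ 1) (sym LHS≡X) (sym S≡T)
    (m+n≤o⇒m≤o∸n X 1+)
    where
    D′ = 2 ^ n ∸ T n m
    1+ : X + 1 ≤ n * D′ + n
    1+ = ≤-certificate 0 lower-bound (begin
      W + n + (X + 1) + 0             ≡⟨ rearrange W n X ⟩
      X + W + (n + 1)                 ≡⟨ cong (_+ (n + 1)) (trans X+W (cong (n *_) (sym (m+[n∸m]≡n T≤2^n)))) ⟩
      n * (T n m + D′) + (n + 1)      ≡⟨ rearrange′ n (T n m) D′ ⟩
      n * T n m + 1 + (n * D′ + n)    ∎)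
      where
      open ≡-Reasoning
      rearrange : ∀ W n X → W + n + (X + 1) + 0 ≡ X + W + (n + 1)
      rearrange = solve-∀
      rearrange′ : ∀ n t d → n * (t + d) + (n + 1) ≡ n * t + 1 + (n * d + n)
      rearrange′ = solve-∀

theorem9 : (n k : ℕ) → .{{_ : NonZero n}} → .{{_ : NonZero k}} → 3 ≤ k → k ≤ n →
    (𝓕 : Family n) → ¬ CopyY k 𝓕 → ¬ CopyY′ k 𝓕 →
    (σ : Permutation′ n) →
    endpoints 𝓕 * n + intervalSum 𝓕 σ
    ≤ n * (2 ^ n ∸ S n k ((n ∸ k + 1) / 2)) + n ∸ 1
theorem9 (suc n₁) (suc (suc (suc k′))) (s≤s (s≤s (s≤s _))) k≤n 𝓕 ¬Y ¬Y′ σ = Main.conclusion n₁ k′ k≤n 𝓕 ¬Y ¬Y′ σ
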